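{- Let $q$ be a prime power, $n=tt'$ with integers $t,t'\ge 2$, and let $f(x)=\sum_{i=0}^{n-1}a_ix^{q^i}\in\mathbb{F}_{q^n}[x]$. Let $U_f=\{(y,f(y))\colon y\in\mathbb{F}_{q^n}\}$ and $U_f^*=U_f\setminus\{(0,0)\}$, and consider (A) $\tilde U_f=\{\langle v\rangle_{\mathbb{F}_q}\colon v\in U_f^*\}$, an $(n-1)$-dimensional subspace of $\mathrm{PG}(\mathbb{F}_{q^n}^2,\mathbb{F}_q)\cong\mathrm{PG}(2n-1,q)$; (B) $R_f=\{\langle v\rangle_{\mathbb{F}_{q^t}}\colon v\in U_f^*\}$, an $\mathbb{F}_q$-linear set of rank $n$ in $\mathrm{PG}(\mathbb{F}_{q^n}^2,\mathbb{F}_{q^t})\cong\mathrm{PG}(2t'-1,q^t)$; (C) $L_f=\{\langle v\rangle_{\mathbb{F}_{q^n}}\colon v\in U_f^*\}$, an $\mathbb{F}_q$-linear set of rank $n$ in $\mathrm{PG}(\mathbb{F}_{q^n}^2,\mathbb{F}_{q^n})\cong\mathrm{PG}(1,q^n)$. Then: (i) $|R_f|=|L_f|$ if and only if $f(x)$ is L-$q^t$-partially scattered. (ii) $R_f$ is a scattered $\mathbb{F}_q$-linear set if and only if $f(x)$ is R-$q^t$-partially scattered; in this case the map $\mu\colon\langle v\rangle_{\mathbb{F}_q}\in\tilde U_f\mapsto\langle v\rangle_{\mathbb{F}_{q^t}}\in R_f$ is bijective. (iii) If $t=2$ and $f(x)$ is R-$q^2$-partially scattered, then $R_f$ is a canonical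 $\mathbb{F}_q$-subgeometry of $\mathrm{PG}(2t'-1,q^2)$.
   Context: A $q$-polynomial $f$ over $\mathbb{F}_{q^n}$ is L-$q^t$-partially scattered if for all $y,z\in\mathbb{F}_{q^n}^*$, $f(y)/y=f(z)/z$ implies $y/z\in\mathbb{F}_{q^t}$. It is R-$q^t$-partially scattered if for all $y,z\in\mathbb{F}_{q^n}^*$, $f(y)/y=f(z)/z$ and $y/z\in\mathbb{F}_{q^t}$ together imply $y/z\in\mathbb{F}_q$. For an $\mathbb{F}_q$-subspace $U$ of an $\mathbb{F}_{q^m}$-vector space $V$, the $\mathbb{F}_q$-linear set $L_U=\{\langle v\rangle_{\mathbb{F}_{q^m}}\colon v\in U\setminus\{0\}\}\subseteq\mathrm{PG}(V,\mathbb{F}_{q^m})$ has rank $\dim_{\mathbb{F}_q}U$; the weight of a point $\langle v\rangle_{\mathbb{F}_{q^m}}$ is $\dim_{\mathbb{F}_q}(\langle v\rangle_{\mathbb{F}_{q^m}}\cap U)$, and $L_U$ is scattered if all its points have weight one. A canonical $\mathbb{F}_q$-subgeometry of $\mathrm{PG}(m-1,q^k)$ is an $\mathbb{F}_q$-linear set of rank $m$ whose projective span is the whole $\mathrm{PG}(m-1,q^k)$. -}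

module Defs where

open import Data.Nat as ℕ using (ℕ; zero; suc; _≤_)
open import Data.Nat.Primality using (Prime)
open import Data.Fin using (Fin; zero; suc)
open import Data.Product using (Σ; ∃; ∃-syntax; _×_; _,_; proj₁; proj₂)
open import Data.Product.Properties using (≡-dec)
open import Data.List using (List; []; _∷_; length; filter; deduplicate)
open import Data.List.Membership.Propositional using (_∈_; lose; find)
open import Data.List.Relation.Unary.Any using (Any; any?)
open import Data.List.Relation.Unary.Unique.Propositional using (Unique)
open import Relation.Nullary using (¬_; Dec; yes; no; ¬?)
open import Relation.Nullary.Decidable using (map′; _×-dec_)
open import Relation.Binary.PropositionalEquality using (_≡_; _≢_; refl)
open import Relation.Binary using (DecidableEquality; Decidable)
open import Algebra.Structures using (IsCommutativeRing)
open import Function.Definitions using (Injective; Surjective)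

IsPrimePower : ℕ → Set
IsPrimePower q = ∃[ p ] ∃[ k ] (Prime p × 1 ≤ k × q ≡ p ℕ.^ k)

-- Finite fields (propositional equality, decidable, explicitly enumerated).
-- The inverse is total with the convention 0⁻¹ = 0; only x⁻¹ for x ≠ 0
-- is constrained.

record FiniteField : Set₁ where
  infixl 7 _*_
  infixl 6 _+_
  field
    F     : Set
    _+_   : F → F → F
    _*_   : F → F → F
    -_    : F → F
    0#    : F
    1#    : F
    _⁻¹   : F → F
    isCommutativeRing : IsCommutativeRing _≡_ _+_ _*_ -_ 0# 1#
    0≢1   : 0# ≢ 1#
    inverse : ∀ x → x ≢ 0# → x * (x ⁻¹) ≡ 1#
    _≟_   : DecidableEquality F
    elems : List F
    elems-complete : ∀ x → x ∈ elems
    elems-unique   : Unique elems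

  order : ℕ
  order = length elems

  _^_ : F → ℕ → F
  x ^ zero  = 1#
  x ^ suc k = x * (x ^ k)

  -- The subfield F_{q^s} = { x | x^(q^s) = x } (for the fixed q)

  InSub : (q s : ℕ) → F → Set
  InSub q s x = x ^ (q ℕ.^ s) ≡ x

  InSub? : (q s : ℕ) → (x : F) → Dec (InSub q s x)
  InSub? q s x = (x ^ (q ℕ.^ s)) ≟ x

  qPoly : (q n : ℕ) → (Fin n → F) → F → F
  qPoly q zero    a x = 0#
  qPoly q (suc n) a x = a zero * (x ^ (q ℕ.^ 0)) + qPoly′ 1 n (λ i → a (suc i))
    where
    qPoly′ : ℕ → (m : ℕ) → (Fin m → F) → F
    qPoly′ j zero    b = 0#
    qPoly′ j (suc m) b = b zero * (x ^ (q ℕ.^ j)) + qPoly′ (suc j) m (λ i → b (suc i))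

  V : Set
  V = F × F

  0V : V
  0V = (0# , 0#)

  _⊕_ : V → V → V
  (a , b) ⊕ (c , d) = (a + c , b + d)

  _·_ : F → V → V
  λ′ · (a , b) = (λ′ * a , λ′ * b)

  lincomb : (k : ℕ) → (Fin k → F) → (Fin k → V) → V
  lincomb zero    c u = 0V
  lincomb (suc k) c u = (c zero · u zero) ⊕ lincomb k (λ i → c (suc i)) (λ i → u (suc i))

  HasDimOver : (q : ℕ) → (V → Set) → ℕ → Set
  HasDimOver q W d =
    Σ (Fin d → V) λ b →
      (∀ i → W (b i)) ×
      (∀ (c : Fin d → F) → (∀ i → InSub q 1 (c i)) → lincomb d c b ≡ 0V → ∀ i → c i ≡ 0#) ×
      (∀ w → W w → Σ (Fin d → F) λ c → (∀ i → InSub q 1 (c i)) × w ≡ lincomb d c b)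

  InU : (f : F → F) → V → Set
  InU f v = f (proj₁ v) ≡ proj₂ v

  Ustar : (f : F → F) → List V
  Ustar f = filter (λ v → ¬? (≡-dec _≟_ _≟_ v 0V)) (Data.List.map (λ y → (y , f y)) elems)

  UstarT : (f : F → F) → Set
  UstarT f = Σ V λ v → InU f v × v ≢ 0V

  -- ⟨v⟩_{F_{q^s}} = ⟨w⟩_{F_{q^s}}  (for nonzero v,w): v = λ w with λ ∈ F_{q^s}^*
  SamePt : (q s : ℕ) → V → V → Set
  SamePt q s v w = ∃[ l ] (InSub q s l × l ≢ 0# × v ≡ l · w)

  SamePt? : (q s : ℕ) → Decidable (SamePt q s)
  SamePt? q s v w =
    map′ (λ a → let (l , _ , p) = find a in l , p)
         (λ { (l , p) → lose (elems-complete l) p })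
         (any? (λ l → InSub? q s l ×-dec (¬? (l ≟ 0#) ×-dec ≡-dec _≟_ _≟_ v (l · w))) elems)

  numPoints : (q s : ℕ) → (f : F → F) → ℕ
  numPoints q s f = length (deduplicate (SamePt? q s) (Ustar f))

  HasWeight : (q s : ℕ) → (f : F → F) → V → ℕ → Set
  HasWeight q s f v w = HasDimOver q (λ u → (∃[ l ] (InSub q s l × u ≡ l · v)) × InU f u) w

  ScatteredLS : (q s : ℕ) → (f : F → F) → Set
  ScatteredLS q s f = ∀ (v : UstarT f) → HasWeight q s f (proj₁ v) 1

  -- μ : ⟨v⟩_{F_q} ↦ ⟨v⟩_{F_{q^s}}, as the identity on representatives
  -- between the setoids (U_f^*, same F_q-point) and (U_f^*, same F_{q^s}-point)
  μ : {f : F → F} → UstarT f → UstarT f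
  μ v = v

  MuBijective : (q s : ℕ) → (f : F → F) → Set
  MuBijective q s f =
    Injective (λ v w → SamePt q 1 (proj₁ v) (proj₁ w)) (λ v w → SamePt q s (proj₁ v) (proj₁ w)) (μ {f}) ×
    Surjective (λ v w → SamePt q 1 (proj₁ v) (proj₁ w)) (λ v w → SamePt q s (proj₁ v) (proj₁ w)) (μ {f})

  -- The linear set { ⟨v⟩_{F_{q^s}} : v ∈ U_f^* } (of rank n, U_f ⊆ F²) is a
  -- canonical F_q-subgeometry of PG(F², F_{q^s}) ≅ PG(m-1, q^s) with m = n:
  -- its underlying F_q-space U_f has F_q-dimension m, and its projective span
  -- (the F_{q^s}-span of U_f) is the whole space F².
  CanonicalSubgeometry : (q s m : ℕ) → (f : F → F) → Set
  CanonicalSubgeometry q s m f =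
    HasDimOver q (InU f) m ×
    (∀ (z : V) → ∃[ k ] Σ (Fin k → F) λ c → Σ (Fin k → V) λ u →
        (∀ i → InSub q s (c i)) × (∀ i → InU f (u i)) × z ≡ lincomb k c u)

  L-PartiallyScattered : (q t : ℕ) → (F → F) → Set
  L-PartiallyScattered q t f =
    ∀ y z → y ≢ 0# → z ≢ 0# → f y * (y ⁻¹) ≡ f z * (z ⁻¹) → InSub q t (y * (z ⁻¹))

  R-PartiallyScattered : (q t : ℕ) → (F → F) → Set
  R-PartiallyScattered q t f =
    ∀ y z → y ≢ 0# → z ≢ 0# → f y * (y ⁻¹) ≡ f z * (z ⁻¹) → InSub q t (y * (z ⁻¹)) →
      InSub q 1 (y * (z ⁻¹))

{-# OPTIONS --safe #-}
module Submission where

-- For nonzero y, z the vectors (y, f(y)) and (z, f(z)) span the same point over F_{q^s} exactly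
-- when f(y)/y = f(z)/z and y/z ∈ F_{q^s}, so both notions of partial scatteredness say that a coarser partition of U_f^*
-- into points agrees with a finer one: F_{q^n} against F_{q^t} for (i), which for nested
-- partitions can be read off the numbers of classes, and F_{q^t} against F_q for (ii).
-- For (iii) take ω ∈ F_{q²} outside F_q. Scatteredness gives U_f ∩ ωU_f = 0, so U_f ⊕ ωU_f has
-- q^{2n} elements and is all of F². That ω exists, and that U_f has dimension n, follows from
-- |{x : x^Q = x}| = Q for |F| = Q^m: at most Q by counting roots, at least Q since the norm
-- x ↦ x^(1+Q+…+Q^(m-1)) maps F into this set with small fibres.

open import Defs
open import Algebra.Bundles using (CommutativeRing; CommutativeMonoid)
open import Algebra.Structures using (IsCommutativeMonoid)
import Algebra.Definitions.RawMonoid as RawMonoid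
import Algebra.Properties.CommutativeSemigroup as CommutativeSemigroupProperties
import Algebra.Properties.CommutativeSemiring.Binomial as Binomial
import Algebra.Properties.CommutativeSemiring.Exp as Exp
import Algebra.Properties.Group as GroupProperties
import Algebra.Properties.Ring as RingProperties
import Algebra.Properties.Semiring.Mult as Mult
import Algebra.Properties.Semiring.Sum as Sum
import Algebra.Solver.Ring.NaturalCoefficients.Default as NaturalCoefficients
open import Data.Fin using (Fin; zero; suc; fromℕ)
open import Data.Fin.Properties using (toℕ-fromℕ; toℕ-inject₁; toℕ<n)
open import Data.List using (List; []; _∷_; length; map; filter; foldr; deduplicate; cartesianProduct; cartesianProductWith)
open import Data.List.Membership.Propositional using (_∈_; _∉_; find; lose)
open import Data.List.Membership.Propositional.Properties
open import Data.List.Membership.Propositional.Properties.WithK using (unique∧set⇒bag)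
open import Data.List.Properties using (length-removeAt′; length-map; length-++)
open import Data.List.Relation.Binary.BagAndSetEquality using (∼bag⇒↭)
open import Data.List.Relation.Binary.Permutation.Propositional using (_↭_; ↭⇒↭ₛ)
open import Data.List.Relation.Binary.Permutation.Propositional.Properties using (↭-length)
import Data.List.Relation.Binary.Permutation.Setoid.Properties as PermutationProperties
open import Data.List.Relation.Unary.All as All using (All; []; _∷_)
open import Data.List.Relation.Unary.All.Properties using (all-filter; ─⁻) renaming (filter⁺ to All-filter⁺)
open import Data.List.Relation.Unary.AllPairs as AllPairs using (AllPairs; []; _∷_)
import Data.List.Relation.Unary.AllPairs.Properties as AllPairsProperties
open import Data.List.Relation.Unary.Any as Any using (Any; here; there; any?; index; _─_)
import Data.List.Relation.Unary.Any.Properties as AnyProperties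
open import Data.List.Relation.Unary.Unique.Propositional using (Unique)
import Data.List.Relation.Unary.Unique.Propositional.Properties as UniqueProperties
import Data.Nat as ℕ
import Data.Nat.Properties as ℕ
import Data.Nat.Divisibility as ℕ
open import Data.Nat using (ℕ; zero; suc; z≤n; s≤s)
open import Data.Nat.Combinatorics using (_C_; nC1≡n; nCn≡1; k>n⇒nCk≡0; nCk+nC[k+1]≡[n+1]C[k+1])
open import Data.Nat.Primality using (Prime; euclidsLemma; prime⇒nonZero; prime⇒nonTrivial)
open import Data.Product using (Σ; ∃; ∃-syntax; _×_; _,_; proj₁; proj₂)
open import Data.Product.Properties using (≡-dec)
open import Data.Sum using (inj₁; inj₂)
open import Data.Vec using (Vec; []; _∷_; replicate; lookup; tabulate)
open import Data.Vec.Properties using (∷-injective; lookup∘tabulate; tabulate∘lookup; tabulate-cong)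
import Data.Vec.Functional as Vector
open import Function using (_∘_)
open import Function.Bundles using (_⇔_; mk⇔; Equivalence)
open import Relation.Binary using (DecidableEquality; IsEquivalence; tri<; tri≈; tri>)
import Relation.Binary as B
open import Relation.Binary.PropositionalEquality
open import Relation.Nullary using (¬_; yes; no; ¬?; contradiction)
open import Relation.Nullary.Decidable using (decidable-stable)
import Relation.Unary as U

-- Pigeonhole and counting in lists

module _ {A : Set} where

  -- Deleting the entry found by `p` keeps the one found by the other witness: no element satisfies
  -- both `P` and `Q`, so the two positions differ.
  ∈-─⁺ : {P Q : A → Set} {ys : List A} (p : Any P ys) → Any Q ys →
         (∀ y → P y → ¬ Q y) → Any Q (ys ─ p)
  ∈-─⁺ (here py)  (here qy)  P⊥Q = contradiction qy (P⊥Q _ py)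
  ∈-─⁺ (here _)   (there qs) P⊥Q = qs
  ∈-─⁺ (there _)  (here qy)  P⊥Q = here qy
  ∈-─⁺ (there ps) (there qs) P⊥Q = there (∈-─⁺ ps qs P⊥Q)

module Pigeonhole {A B : Set} (R : A → B → Set) where

  Separated : List A → Set
  Separated = AllPairs (λ x x′ → ∀ y → R x y → ¬ R x′ y)

  remaining : ∀ {x xs ys} (p : Any (R x) ys) → All (λ x′ → ∀ y → R x y → ¬ R x′ y) xs →
              All (λ x → Any (R x) ys) xs → All (λ x → Any (R x) (ys ─ p)) xs
  remaining p sep covered = All.zipWith (λ (d , q) → ∈-─⁺ p q d) (sep , covered)

  -- Match the head of `xs` with some entry of `ys` and delete that entry; separation keeps the
  -- other elements of `xs` covered by what is left.
  length-≤ : ∀ {xs ys} → Separated xs → All (λ x → Any (R x) ys) xs → length xs ℕ.≤ length ys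
  length-≤ []          []            = z≤n
  length-≤ {ys = ys} (sep ∷ seps) (p ∷ ps) =
    subst (suc _ ℕ.≤_) (sym (length-removeAt′ ys (index p)))
      (s≤s (length-≤ seps (remaining p sep ps)))

  -- Each `x` uses up its own entry of `ys`, so when `ys` is no longer than `xs` no entry of `ys`
  -- stays unmatched.
  onto : ∀ {xs ys} → Separated xs → All (λ x → Any (R x) ys) xs → length ys ℕ.≤ length xs →
         All (λ y → Any (λ x → R x y) xs) ys
  onto {ys = []} _ _ _ = []
  onto {ys = ys@(_ ∷ _)} (sep ∷ seps) (p ∷ ps) ≤ =
    ─⁻ p (here (AnyProperties.lookup-result p))
      (All.map there (onto seps (remaining p sep ps)
        (ℕ.s≤s⁻¹ (ℕ.≤-trans (ℕ.≤-reflexive (sym (length-removeAt′ ys (index p)))) ≤))))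

module _ {A : Set} {xs ys : List A} (xs! : Unique xs) (xs⊆ys : ∀ {x} → x ∈ xs → x ∈ ys) where

  open Pigeonhole {A} {A} _≡_

  private
    separated : Separated xs
    separated = AllPairs.map (λ x≢x′ _ x≡y x′≡y → x≢x′ (trans x≡y (sym x′≡y))) xs!

  unique-⊆⇒length-≤ : length xs ℕ.≤ length ys
  unique-⊆⇒length-≤ = length-≤ separated (All.tabulate xs⊆ys)

  unique-⊆⇒⊇ : length ys ℕ.≤ length xs → ∀ {y} → y ∈ ys → y ∈ xs
  unique-⊆⇒⊇ ≤ y∈ys = Any.map sym (All.lookup (onto separated (All.tabulate xs⊆ys) ≤) y∈ys)

unique-set⇒↭ : {A : Set} {xs ys : List A} → Unique xs → Unique ys →
               (∀ {x} → x ∈ xs ⇔ x ∈ ys) → xs ↭ ys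
unique-set⇒↭ xs! ys! xs⇔ys = ∼bag⇒↭ (unique∧set⇒bag xs! ys! xs⇔ys)

-- By the pigeonhole principle an injective self-map of a finite set is onto. Applied below to
-- translations by 1 and to multiplications by nonzero elements.
map-permutes : {A : Set} {xs : List A} (f : A → A) → (∀ {x y} → f x ≡ f y → x ≡ y) →
               (∀ {x} → x ∈ xs → f x ∈ xs) → Unique xs → map f xs ↭ xs
map-permutes {xs = xs} f f-inj f-closed xs! =
  unique-set⇒↭ map! xs! (mk⇔ map⊆ (unique-⊆⇒⊇ map! map⊆ (ℕ.≤-reflexive (sym (length-map f xs)))))
  where
  map! = UniqueProperties.map⁺ f-inj xs!
  map⊆ : ∀ {x} → x ∈ map f xs → x ∈ xs
  map⊆ x∈ with _ , y∈ , refl ← ∈-map⁻ f x∈ = f-closed y∈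

length-filter-¬? : {A : Set} {P : A → Set} (P? : U.Decidable P) (xs : List A) →
                   length xs ≡ length (filter P? xs) ℕ.+ length (filter (¬? ∘ P?) xs)
length-filter-¬? P? [] = refl
length-filter-¬? P? (x ∷ xs) with P? x
... | yes _ = cong suc (length-filter-¬? P? xs)
... | no _  = trans (cong suc (length-filter-¬? P? xs)) (sym (ℕ.+-suc _ _))

-- Split off the fibre over the first element of `ys`; everything else is sent into the tail.
length-≤-fibres : {A B : Set} (_≟_ : DecidableEquality B) (g : A → B) (m : ℕ) →
  (∀ y {zs} → Unique zs → All (λ x → g x ≡ y) zs → length zs ℕ.≤ m) →
  ∀ {xs} → Unique xs → ∀ ys → All (λ x → g x ∈ ys) xs → length xs ℕ.≤ length ys ℕ.* m
length-≤-fibres _≟_ g m bound {[]} _ _ _ = z≤n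
length-≤-fibres _≟_ g m bound {_ ∷ _} _ [] (() ∷ _)
length-≤-fibres _≟_ g m bound {xs@(_ ∷ _)} xs! (y ∷ ys) cover = begin
  length xs                            ≡⟨ length-filter-¬? P? xs ⟩
  length in-fibre ℕ.+ length outside   ≤⟨ ℕ.+-mono-≤ (bound y (UniqueProperties.filter⁺ P? xs!) (all-filter P? xs))
                                            (length-≤-fibres _≟_ g m bound (UniqueProperties.filter⁺ (¬? ∘ P?) xs!) ys outside-cover) ⟩
  m ℕ.+ length ys ℕ.* m                ∎
  where
  open ℕ.≤-Reasoning
  P? = λ x → g x ≟ y
  in-fibre = filter P? xs
  outside = filter (¬? ∘ P?) xs
  outside-cover : All (λ x → g x ∈ ys) outside
  outside-cover = All.zipWith (λ (g∈ , g≢) → Any.tail g≢ g∈)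
    (All-filter⁺ (¬? ∘ P?) cover , all-filter (¬? ∘ P?) xs)

-- Representatives of equivalence classes

filter-cong-∈ : {A : Set} {P Q : A → Set} (P? : U.Decidable P) (Q? : U.Decidable Q) {xs : List A} →
                All (λ x → P x ⇔ Q x) xs → filter P? xs ≡ filter Q? xs
filter-cong-∈ P? Q? [] = refl
filter-cong-∈ P? Q? {x ∷ xs} (P⇔Q ∷ rest) with P? x | Q? x
... | yes p | yes q = cong (x ∷_) (filter-cong-∈ P? Q? rest)
... | no ¬p | no ¬q = filter-cong-∈ P? Q? rest
... | yes p | no ¬q = contradiction (Equivalence.to P⇔Q p) ¬q
... | no ¬p | yes q = contradiction (Equivalence.from P⇔Q q) ¬p

deduplicate-separated : {A : Set} {R : A → A → Set} (R? : B.Decidable R) (xs : List A) →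
                        AllPairs (λ x y → ¬ R x y) (deduplicate R? xs)
deduplicate-separated R? [] = []
deduplicate-separated R? (x ∷ xs) =
  all-filter (¬? ∘ R? x) (deduplicate R? xs) ∷
  AllPairsProperties.filter⁺ (¬? ∘ R? x) (deduplicate-separated R? xs)

deduplicate-covers : {A : Set} {R : A → A → Set} (R? : B.Decidable R) → IsEquivalence R →
                     ∀ {x xs} → x ∈ xs → Any (R x) (deduplicate R? xs)
deduplicate-covers R? R-eq x∈xs =
  AnyProperties.deduplicate⁺ R? (λ a~b x~b → R.trans x~b (R.sym a~b)) (Any.map R.reflexive x∈xs)
  where module R = IsEquivalence R-eq

module _ {A : Set} {R S : A → A → Set} (R? : B.Decidable R) (S? : B.Decidable S) where

  -- Agreement is asked for on members of `xs` only: it will come from partial scatteredness, which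
  -- speaks about U_f^* alone.
  deduplicate-cong : ∀ {xs} → (∀ {x y} → x ∈ xs → y ∈ xs → R x y ⇔ S x y) →
                     deduplicate R? xs ≡ deduplicate S? xs
  deduplicate-cong {[]} R⇔S = refl
  deduplicate-cong {x ∷ xs} R⇔S
    rewrite deduplicate-cong {xs} (λ x∈ y∈ → R⇔S (there x∈) (there y∈)) =
    cong (x ∷_) (filter-cong-∈ (¬? ∘ R? x) (¬? ∘ S? x) (All.tabulate λ y∈ →
      let R⇔S′ = R⇔S (here refl) (there (∈-deduplicate⁻ S? xs y∈))
      in mk⇔ (_∘ Equivalence.from R⇔S′) (_∘ Equivalence.to R⇔S′)))

  -- Each representative for the coarser relation S is R-related to a representative for R, and
  -- this matching is injective; for equally many classes it is also onto.
  deduplicate-length⁻ : IsEquivalence R → IsEquivalence S → (∀ {x y} → R x y → S x y) →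
    ∀ xs → length (deduplicate R? xs) ≡ length (deduplicate S? xs) →
    ∀ {x y} → x ∈ xs → y ∈ xs → S x y → R x y
  deduplicate-length⁻ R-eq S-eq R⇒S xs |R|≡|S| {x} {y} x∈ y∈ xSy =
    same (S-representative x∈) (S-representative y∈)
    where
    module R = IsEquivalence R-eq
    module S = IsEquivalence S-eq
    open Pigeonhole R

    S-representative : ∀ {z} → z ∈ xs → Any (R z) (deduplicate S? xs)
    S-representative z∈ =
      let a , a∈ , zRa = find (deduplicate-covers R? R-eq z∈)
      in Any.map (λ bRa → R.trans zRa (R.sym bRa)) (All.lookup
           (onto (AllPairs.map (λ ¬bSb′ _ bRa b′Ra → ¬bSb′ (R⇒S (R.trans bRa (R.sym b′Ra))))
                               (deduplicate-separated S? xs))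
                 (All.tabulate (λ b∈ → deduplicate-covers R? R-eq (∈-deduplicate⁻ S? xs b∈)))
                 (ℕ.≤-reflexive |R|≡|S|)) a∈)

    -- The representatives reached from x and y are S-related through x and y, so separation forces
    -- them to be one and the same.
    same : Any (R x) (deduplicate S? xs) → Any (R y) (deduplicate S? xs) → R x y
    same p q with b , b∈ , xRb ← find p | b′ , b′∈ , yRb′ ← find q
             with ∈-AllPairs₂ (deduplicate-separated S? xs) b∈ b′∈
    ... | inj₁ refl          = R.trans xRb (R.sym yRb′)
    ... | inj₂ (inj₁ ¬bSb′)  = contradiction (S.trans (S.sym (R⇒S xRb)) (S.trans xSy (R⇒S yRb′))) ¬bSb′
    ... | inj₂ (inj₂ ¬b′Sb)  = contradiction (S.trans (S.sym (R⇒S yRb′)) (S.trans (S.sym xSy) (R⇒S xRb))) ¬b′Sb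

-- Frobenius and Fermat in a finite field

module _ {A : Set} {_∙_ : A → A → A} {ε : A} (M : IsCommutativeMonoid _≡_ _∙_ ε) where

  private
    commutativeMonoid : CommutativeMonoid _ _
    commutativeMonoid = record { isCommutativeMonoid = M }
  open CommutativeMonoid commutativeMonoid using (identityˡ; commutativeSemigroup; rawMonoid)
  open CommutativeSemigroupProperties commutativeSemigroup using (interchange)
  open RawMonoid rawMonoid using () renaming (_×_ to _×ₙ_)

  foldr-map-∙ : ∀ x ys → foldr _∙_ ε (map (x ∙_) ys) ≡ (length ys ×ₙ x) ∙ foldr _∙_ ε ys
  foldr-map-∙ x [] = sym (identityˡ ε)
  foldr-map-∙ x (y ∷ ys) = trans (cong ((x ∙ y) ∙_) (foldr-map-∙ x ys)) (interchange x y _ _)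

  -- Compares the total over a list with the total over its translate. Additively this yields
  -- `order×1≡0`, multiplicatively Fermat's theorem.
  foldr-translate : ∀ x ys → map (x ∙_) ys ↭ ys → (length ys ×ₙ x) ∙ foldr _∙_ ε ys ≡ foldr _∙_ ε ys
  foldr-translate x ys perm = trans (sym (foldr-map-∙ x ys))
    (PermutationProperties.foldr-commMonoid (setoid A) M (↭⇒↭ₛ perm))

-- The absorption identity, by induction with Pascal's rule; its right side is visibly divisible by
-- n + 1.
C-absorption : ∀ n k → suc k ℕ.* (suc n C suc k) ≡ suc n ℕ.* (n C k)
C-absorption n zero = trans (ℕ.*-identityˡ _) (trans (nC1≡n (suc n)) (sym (ℕ.*-identityʳ (suc n))))
C-absorption zero (suc k) = trans (cong (suc (suc k) ℕ.*_) (k>n⇒nCk≡0 {1} {suc (suc k)} (s≤s (s≤s z≤n))))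
  (trans (ℕ.*-zeroʳ (suc (suc k))) (sym (trans (ℕ.*-identityˡ _) (k>n⇒nCk≡0 {0} {suc k} (s≤s z≤n)))))
C-absorption (suc n) (suc k) = begin
  suc (suc k) ℕ.* (suc (suc n) C suc (suc k))
    ≡⟨ cong (suc (suc k) ℕ.*_) (nCk+nC[k+1]≡[n+1]C[k+1] (suc n) (suc k)) ⟨
  suc (suc k) ℕ.* (c ℕ.+ (suc n C suc (suc k)))
    ≡⟨ ℕ.*-distribˡ-+ (suc (suc k)) c _ ⟩
  (c ℕ.+ suc k ℕ.* c) ℕ.+ suc (suc k) ℕ.* (suc n C suc (suc k))
    ≡⟨ cong₂ (λ a b → (c ℕ.+ a) ℕ.+ b) (C-absorption n k) (C-absorption n (suc k)) ⟩
  (c ℕ.+ suc n ℕ.* (n C k)) ℕ.+ suc n ℕ.* (n C suc k)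
    ≡⟨ ℕ.+-assoc c _ _ ⟩
  c ℕ.+ (suc n ℕ.* (n C k) ℕ.+ suc n ℕ.* (n C suc k))
    ≡⟨ cong (c ℕ.+_) (ℕ.*-distribˡ-+ (suc n) (n C k) _) ⟨
  c ℕ.+ suc n ℕ.* ((n C k) ℕ.+ (n C suc k))
    ≡⟨ cong (λ a → c ℕ.+ suc n ℕ.* a) (nCk+nC[k+1]≡[n+1]C[k+1] n k) ⟩
  suc (suc n) ℕ.* c ∎
  where
  open ≡-Reasoning
  c = suc n C suc k

-- By absorption the prime divides (k+1) times the binomial coefficient, and it cannot divide the
-- smaller positive number k + 1.
prime∣C : ∀ {p k} → Prime (suc p) → suc k ℕ.< suc p → suc p ℕ.∣ (suc p C suc k)
prime∣C {p} {k} p-prime k<p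
  with euclidsLemma (suc k) (suc p C suc k) p-prime
         (subst (suc p ℕ.∣_) (sym (C-absorption p k)) (ℕ.m∣m*n (p C k)))
... | inj₁ p∣k = contradiction p∣k (ℕ.>⇒∤ k<p)
... | inj₂ p∣C = p∣C

module FieldProperties (K : FiniteField) where
  open FiniteField K

  commutativeRing : CommutativeRing _ _
  commutativeRing = record { isCommutativeRing = isCommutativeRing }

  open CommutativeRing commutativeRing public using
    ( +-assoc; +-comm; +-identityˡ; +-identityʳ; -‿inverseˡ; -‿inverseʳ
    ; *-assoc; *-comm; *-identityˡ; *-identityʳ; zeroˡ; zeroʳ; distribˡ
    ; +-isCommutativeMonoid; *-isCommutativeMonoid; +-group; ring; semiring; commutativeSemiring )
  open GroupProperties +-group using () renaming (∙-cancelˡ to +-cancelˡ; ∙-cancelʳ to +-cancelʳ; identityˡ-unique to +-identityˡ-unique; inverseˡ-unique to +-inverseˡ-unique) public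
  open Mult semiring using (×1-homo-*; ×-assoc-*) renaming (_×_ to _×ₙ_) public
  module ^ = Exp commutativeSemiring
  open RingProperties ring using (-1*x≈-x) public
  open NaturalCoefficients commutativeSemiring using (solve; con; _:=_; _:+_; _:*_) public

  *-cancelˡ : ∀ {x y z} → x ≢ 0# → x * y ≡ x * z → y ≡ z
  *-cancelˡ {x} {y} {z} x≢0 xy≡xz = trans (sym (x⁻¹xy y)) (trans (cong (x ⁻¹ *_) xy≡xz) (x⁻¹xy z))
    where
    x⁻¹xy : ∀ y → x ⁻¹ * (x * y) ≡ y
    x⁻¹xy y = trans (sym (*-assoc _ _ _)) (trans (cong (_* y) (trans (*-comm _ _) (inverse x x≢0))) (*-identityˡ y))

  *-cancelʳ : ∀ {x y z} → z ≢ 0# → x * z ≡ y * z → x ≡ y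
  *-cancelʳ z≢0 xz≡yz = *-cancelˡ z≢0 (trans (*-comm _ _) (trans xz≡yz (*-comm _ _)))

  *≢0 : ∀ {x y} → x ≢ 0# → y ≢ 0# → x * y ≢ 0#
  *≢0 x≢0 y≢0 xy≡0 = y≢0 (*-cancelˡ x≢0 (trans xy≡0 (sym (zeroʳ _))))

  ⁻¹≢0 : ∀ {x} → x ≢ 0# → x ⁻¹ ≢ 0#
  ⁻¹≢0 {x} x≢0 x⁻¹≡0 = 0≢1 (trans (sym (zeroʳ x)) (trans (cong (x *_) (sym x⁻¹≡0)) (inverse x x≢0)))

  *x⁻¹*x : ∀ {x} y → x ≢ 0# → (y * x ⁻¹) * x ≡ y
  *x⁻¹*x {x} y x≢0 = trans (*-assoc _ _ _) (trans (cong (y *_) (trans (*-comm _ _) (inverse x x≢0))) (*-identityʳ y))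

  *x*x⁻¹ : ∀ {x} y → x ≢ 0# → (y * x) * x ⁻¹ ≡ y
  *x*x⁻¹ {x} y x≢0 = trans (*-assoc _ _ _) (trans (cong (y *_) (inverse x x≢0)) (*-identityʳ y))

  ^≡^ : ∀ x n → x ^ n ≡ x ^.^ n
  ^≡^ x zero = refl
  ^≡^ x (suc n) = cong (x *_) (^≡^ x n)

  ^-+ : ∀ x m n → x ^ (m ℕ.+ n) ≡ x ^ m * x ^ n
  ^-+ x m n rewrite ^≡^ x (m ℕ.+ n) | ^≡^ x m | ^≡^ x n = ^.^-homo-* x m n

  ^-^ : ∀ x m n → (x ^ m) ^ n ≡ x ^ (m ℕ.* n)
  ^-^ x m n rewrite ^≡^ (x ^ m) n | ^≡^ x m | ^≡^ x (m ℕ.* n) = ^.^-assocʳ x m n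

  *-^ : ∀ x y n → (x * y) ^ n ≡ x ^ n * y ^ n
  *-^ x y n rewrite ^≡^ (x * y) n | ^≡^ x n | ^≡^ y n = ^.^-distrib-* x y n

  1^ : ∀ n → 1# ^ n ≡ 1#
  1^ zero = refl
  1^ (suc n) = trans (*-identityˡ _) (1^ n)

  0^ : ∀ {n} → 0 ℕ.< n → 0# ^ n ≡ 0#
  0^ (s≤s _) = zeroˡ _

  ^≢0 : ∀ {x} n → x ≢ 0# → x ^ n ≢ 0#
  ^≢0 zero    x≢0 = 0≢1 ∘ sym
  ^≢0 (suc n) x≢0 = *≢0 x≢0 (^≢0 n x≢0)

  -- Adding 1 permutes the field, so the sum S of all elements satisfies |F|·1 + S = S.
  order×1≡0 : order ×ₙ 1# ≡ 0#
  order×1≡0 = +-identityˡ-unique _ _ (foldr-translate +-isCommutativeMonoid 1# elems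
    (map-permutes (1# +_) (+-cancelˡ 1# _ _) (λ _ → elems-complete _) elems-unique))

  -- There are no zero divisors: if p·1 were nonzero, it could be cancelled from p^m·1 = 0 factor by
  -- factor until 1 = 0.
  prime-power-order⇒char : ∀ p m → order ≡ p ℕ.^ m → p ×ₙ 1# ≡ 0#
  prime-power-order⇒char p m order≡ = reduced m (trans (cong (_×ₙ 1#) (sym order≡)) order×1≡0)
    where
    reduced : ∀ m → (p ℕ.^ m) ×ₙ 1# ≡ 0# → p ×ₙ 1# ≡ 0#
    reduced zero 1≡0 = contradiction (trans (sym 1≡0) (+-identityʳ 1#)) 0≢1
    reduced (suc m) eq with (p ×ₙ 1#) ≟ 0#
    ... | yes p≡0 = p≡0
    ... | no p≢0 = reduced m (*-cancelˡ p≢0 (trans (sym (×1-homo-* p (p ℕ.^ m))) (trans eq (sym (zeroʳ _)))))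

  char∣⇒×≡0 : ∀ {p m} → p ×ₙ 1# ≡ 0# → p ℕ.∣ m → ∀ x → m ×ₙ x ≡ 0#
  char∣⇒×≡0 {p} p×1≡0 (ℕ.divides k refl) x = begin
    (k ℕ.* p) ×ₙ x          ≡⟨ cong ((k ℕ.* p) ×ₙ_) (*-identityˡ x) ⟨
    (k ℕ.* p) ×ₙ (1# * x)   ≡⟨ ×-assoc-* (k ℕ.* p) 1# x ⟨
    (k ℕ.* p) ×ₙ 1# * x     ≡⟨ cong (_* x) (×1-homo-* k p) ⟩
    (k ×ₙ 1#) * (p ×ₙ 1#) * x ≡⟨ cong (λ y → (k ×ₙ 1#) * y * x) p×1≡0 ⟩
    (k ×ₙ 1#) * 0# * x      ≡⟨ cong (_* x) (zeroʳ _) ⟩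
    0# * x                  ≡⟨ zeroˡ x ⟩
    0#                      ∎
    where open ≡-Reasoning

  frobenius-+ : ∀ {p} → Prime p → p ×ₙ 1# ≡ 0# → ∀ x y → (x + y) ^ p ≡ x ^ p + y ^ p
  frobenius-+ {suc p} p-prime char x y = begin
    (x + y) ^ suc p                              ≡⟨ ^≡^ (x + y) (suc p) ⟩
    (x + y) ^.^ suc p                            ≡⟨ Binomial.theorem commutativeSemiring (suc p) x y ⟩
    term zero + sum (term ∘ suc)                 ≡⟨ cong (term zero +_) (sum-init-last (term ∘ suc)) ⟩
    term zero + (sum (Vector.init (term ∘ suc)) + term (suc (fromℕ p)))
      -- The index is the exponent of x: index 0 gives y^p, the last index gives x^p, and the inner
      -- coefficients vanish by `prime∣C`.
      ≡⟨ cong₂ (λ a b → a + (b + term (suc (fromℕ p)))) first (trans (sum-cong-≋ middle) (sum-replicate-zero p)) ⟩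
    y ^ suc p + (0# + term (suc (fromℕ p)))      ≡⟨ cong (y ^ suc p +_) (trans (+-identityˡ _) end) ⟩
    y ^ suc p + x ^ suc p                        ≡⟨ +-comm _ _ ⟩
    x ^ suc p + y ^ suc p                        ∎
    where
    open ≡-Reasoning
    open Sum semiring using (sum; sum-init-last; sum-cong-≋; sum-replicate-zero)
    term = Binomial.binomialTerm commutativeSemiring x y (suc p)
    first : term zero ≡ y ^ suc p
    first = trans (+-identityʳ _) (trans (*-identityˡ _) (sym (^≡^ y (suc p))))
    end : term (suc (fromℕ p)) ≡ x ^ suc p
    end rewrite toℕ-fromℕ p | nCn≡1 (suc p) | ℕ.n∸n≡0 p | ^≡^ x p = trans (+-identityʳ _) (*-identityʳ _)
    middle : ∀ i → Vector.init (term ∘ suc) i ≡ 0#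
    middle i = char∣⇒×≡0 char
      (prime∣C p-prime (s≤s (subst (ℕ._< p) (sym (toℕ-inject₁ i)) (toℕ<n i)))) _

  frobenius-^-+ : ∀ {p} → Prime p → p ×ₙ 1# ≡ 0# → ∀ m x y → (x + y) ^ (p ℕ.^ m) ≡ x ^ (p ℕ.^ m) + y ^ (p ℕ.^ m)
  frobenius-^-+ p-prime char zero x y = trans (*-identityʳ _) (cong₂ _+_ (sym (*-identityʳ x)) (sym (*-identityʳ y)))
  frobenius-^-+ {p} p-prime char (suc m) x y = begin
    (x + y) ^ (p ℕ.* p ℕ.^ m)                        ≡⟨ ^-^ (x + y) p (p ℕ.^ m) ⟨
    ((x + y) ^ p) ^ (p ℕ.^ m)                        ≡⟨ cong (_^ (p ℕ.^ m)) (frobenius-+ p-prime char x y) ⟩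
    (x ^ p + y ^ p) ^ (p ℕ.^ m)                      ≡⟨ frobenius-^-+ p-prime char m (x ^ p) (y ^ p) ⟩
    (x ^ p) ^ (p ℕ.^ m) + (y ^ p) ^ (p ℕ.^ m)        ≡⟨ cong₂ _+_ (^-^ x p (p ℕ.^ m)) (^-^ y p (p ℕ.^ m)) ⟩
    x ^ (p ℕ.* p ℕ.^ m) + y ^ (p ℕ.* p ℕ.^ m)        ∎
    where open ≡-Reasoning

  prime-power-frobenius-+ : ∀ {q} → IsPrimePower q → ∀ n → order ≡ q ℕ.^ n →
    ∀ s x y → (x + y) ^ (q ℕ.^ s) ≡ x ^ (q ℕ.^ s) + y ^ (q ℕ.^ s)
  prime-power-frobenius-+ (p , k , p-prime , _ , refl) n order≡ s x y rewrite ℕ.^-*-assoc p k s =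
    frobenius-^-+ p-prime (prime-power-order⇒char p (k ℕ.* n) (trans order≡ (ℕ.^-*-assoc p k n))) (k ℕ.* s) x y

  nonzeros : List F
  nonzeros = filter (λ x → ¬? (x ≟ 0#)) elems

  nonzeros-unique : Unique nonzeros
  nonzeros-unique = UniqueProperties.filter⁺ _ elems-unique

  ∈-nonzeros⁺ : ∀ {x} → x ≢ 0# → x ∈ nonzeros
  ∈-nonzeros⁺ = ∈-filter⁺ _ (elems-complete _)

  ∈-nonzeros⁻ : ∀ {x} → x ∈ nonzeros → x ≢ 0#
  ∈-nonzeros⁻ = proj₂ ∘ ∈-filter⁻ (λ x → ¬? (x ≟ 0#)) {xs = elems}

  order≡1+nonzeros : order ≡ suc (length nonzeros)
  order≡1+nonzeros = ↭-length (unique-set⇒↭ elems-unique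
    (All.tabulate (λ x∈ 0≡x → ∈-nonzeros⁻ x∈ (sym 0≡x)) ∷ nonzeros-unique)
    (λ {x} → mk⇔ (λ _ → split x) (λ _ → elems-complete x)))
    where
    split : ∀ x → x ∈ 0# ∷ nonzeros
    split x with x ≟ 0#
    ... | yes x≡0 = here x≡0
    ... | no x≢0  = there (∈-nonzeros⁺ x≢0)

  -- Multiplication by a nonzero x permutes the nonzero elements; cancelling their product leaves
  -- x^(|F|-1) = 1.
  x^order≡x : ∀ x → x ^ order ≡ x
  x^order≡x x with x ≟ 0#
  ... | yes refl = trans (cong (0# ^_) order≡1+nonzeros) (zeroˡ _)
  ... | no x≢0 = trans (cong (x ^_) order≡1+nonzeros) (trans (cong (x *_) x^[q-1]≡1) (*-identityʳ x))
    where
    product = foldr _*_ 1#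
    product≢0 : ∀ {xs} → All (_≢ 0#) xs → product xs ≢ 0#
    product≢0 [] = 0≢1 ∘ sym
    product≢0 (x≢0 ∷ xs≢0) = *≢0 x≢0 (product≢0 xs≢0)
    x^[q-1]≡1 : x ^ length nonzeros ≡ 1#
    x^[q-1]≡1 = *-cancelʳ (product≢0 (All.tabulate ∈-nonzeros⁻)) (begin
      x ^ length nonzeros * product nonzeros    ≡⟨ cong (_* product nonzeros) (^≡^ x (length nonzeros)) ⟩
      x ^.^ length nonzeros * product nonzeros  ≡⟨ foldr-translate *-isCommutativeMonoid x nonzeros
        (map-permutes (x *_) (*-cancelˡ x≢0) (λ y∈ → ∈-nonzeros⁺ (*≢0 x≢0 (∈-nonzeros⁻ y∈))) nonzeros-unique) ⟩
      product nonzeros                          ≡⟨ *-identityˡ _ ⟨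
      1# * product nonzeros                     ∎)
      where open ≡-Reasoning

  -- Roots of polynomials

  -- Coefficients come lowest degree first and the leading 1 is implicit, so the vector length is
  -- the degree and the polynomial is never zero.
  monic : ∀ {d} → Vec F d → F → F
  monic []       x = 1#
  monic (c ∷ cs) x = c + x * monic cs x

  -- Synthetic division by x - a: the Horner values of the successive tails at a are the
  -- coefficients of the quotient.
  quotient : ∀ {d} → F → Vec F (suc d) → Vec F d
  quotient a (_ ∷ [])         = []
  quotient a (_ ∷ cs@(_ ∷ _)) = monic cs a ∷ quotient a cs

  -- P(x) − P(a) = (x − a) Q(x), moved around so that it is a semiring identity.
  monic-quotient : ∀ {d} a (cs : Vec F (suc d)) x →
    monic cs x + a * monic (quotient a cs) x ≡ monic cs a + x * monic (quotient a cs) x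
  monic-quotient a (c ∷ []) x =
    solve 3 (λ c a x → c :+ x :* con 1 :+ a :* con 1 := c :+ a :* con 1 :+ x :* con 1) refl c a x
  monic-quotient a (c ∷ cs@(_ ∷ _)) x = begin
    c + x * monic cs x + a * (monic cs a + x * q)
      ≡⟨ solve 6 (λ c x p a r q → c :+ x :* p :+ a :* (r :+ x :* q) := c :+ a :* r :+ x :* (p :+ a :* q))
           refl c x (monic cs x) a (monic cs a) q ⟩
    c + a * monic cs a + x * (monic cs x + a * q)
      ≡⟨ cong (λ y → c + a * monic cs a + x * y) (monic-quotient a cs x) ⟩
    c + a * monic cs a + x * (monic cs a + x * q) ∎
    where
    open ≡-Reasoning
    q = monic (quotient a cs) x

  -- Divide by x - a for the first root a; all the other roots are roots of the quotient, whose
  -- degree is one less.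
  length-roots-≤ : ∀ {d} (cs : Vec F d) {xs} → Unique xs → All (λ x → monic cs x ≡ 0#) xs → length xs ℕ.≤ d
  length-roots-≤ cs [] [] = z≤n
  length-roots-≤ [] (_ ∷ _) (1≡0 ∷ _) = contradiction (sym 1≡0) 0≢1
  length-roots-≤ cs@(_ ∷ _) {a ∷ _} (a∉ ∷ xs!) (a-root ∷ roots) =
    s≤s (length-roots-≤ (quotient a cs) xs! (All.zipWith (λ (a≢x , x-root) → root a≢x x-root) (a∉ , roots)))
    where
    root : ∀ {x} → a ≢ x → monic cs x ≡ 0# → monic (quotient a cs) x ≡ 0#
    root {x} a≢x x-root with monic (quotient a cs) x ≟ 0#
    ... | yes ≡0 = ≡0
    -- With P(x) = P(a) = 0 the division identity reads 0 + a Q(x) = 0 + x Q(x), and Q(x) ≠ 0 would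
    -- give a = x.
    ... | no ≢0 = contradiction (*-cancelʳ ≢0 (+-cancelˡ 0# _ _
      (trans (cong (_+ a * q) (sym x-root)) (trans (monic-quotient a cs x) (cong (_+ x * q) a-root))))) a≢x
      where q = monic (quotient a cs) x

  monic-0s : ∀ d x → monic (replicate d 0#) x ≡ x ^ d
  monic-0s zero x = refl
  monic-0s (suc d) x = trans (+-identityˡ _) (cong (x *_) (monic-0s d x))

  length-^-fibre-≤ : ∀ d → 0 ℕ.< d → ∀ y {xs} → Unique xs → All (λ x → x ^ d ≡ y) xs → length xs ℕ.≤ d
  length-^-fibre-≤ (suc d) _ y xs! xs^ = length-roots-≤ (- y ∷ replicate d 0#) xs!
    (All.map (λ {x} x^≡y → trans (cong (λ z → - y + x * z) (monic-0s d x))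
                                 (trans (cong (- y +_) x^≡y) (-‿inverseˡ y))) xs^)

  -- The number of fixed points of x ↦ x^Q

  fixed : ℕ → List F
  fixed Q = filter (λ x → (x ^ Q) ≟ x) elems

  fixed-unique : ∀ Q → Unique (fixed Q)
  fixed-unique Q = UniqueProperties.filter⁺ _ elems-unique

  ∈-fixed⁺ : ∀ Q {x} → x ^ Q ≡ x → x ∈ fixed Q
  ∈-fixed⁺ Q = ∈-filter⁺ _ (elems-complete _)

  ∈-fixed⁻ : ∀ Q {x} → x ∈ fixed Q → x ^ Q ≡ x
  ∈-fixed⁻ Q = proj₂ ∘ ∈-filter⁻ (λ x → (x ^ Q) ≟ x) {xs = elems}

  length-fixed-≤ : ∀ Q → 2 ℕ.≤ Q → length (fixed Q) ℕ.≤ Q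
  length-fixed-≤ (suc zero) (s≤s ())
  -- The polynomial x^Q - x with coefficients 0, -1, 0, ..., 0; Q ≥ 2 keeps the term -x below the
  -- leading one.
  length-fixed-≤ (suc (suc d)) _ = length-roots-≤ (0# ∷ - 1# ∷ replicate d 0#) (fixed-unique (suc (suc d)))
    (All.tabulate (λ {x} x∈ → root {x} (∈-fixed⁻ (suc (suc d)) x∈)))
    where
    open ≡-Reasoning
    root : ∀ {x} → x ^ suc (suc d) ≡ x → 0# + x * (- 1# + x * monic (replicate d 0#) x) ≡ 0#
    root {x} fix = begin
      0# + x * (- 1# + x * monic (replicate d 0#) x) ≡⟨ +-identityˡ _ ⟩
      x * (- 1# + x * monic (replicate d 0#) x)      ≡⟨ distribˡ x _ _ ⟩
      x * - 1# + x * (x * monic (replicate d 0#) x)  ≡⟨ cong₂ (λ a b → a + x * (x * b)) (trans (*-comm x _) (-1*x≈-x x)) (monic-0s d x) ⟩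
      - x + x ^ suc (suc d)                          ≡⟨ cong (- x +_) fix ⟩
      - x + x                                        ≡⟨ -‿inverseˡ x ⟩
      0#                                             ∎

  -- 1 + Q + ... + Q^(m-1) in Horner form: the exponent of the norm when the field has Q^m elements.
  repunit : ℕ → ℕ → ℕ
  repunit Q zero    = 0
  repunit Q (suc m) = 1 ℕ.+ Q ℕ.* repunit Q m

  repunit-^ : ∀ Q m → Q ℕ.^ m ℕ.+ repunit Q m ≡ repunit Q (suc m)
  repunit-^ Q zero = cong suc (sym (ℕ.*-zeroʳ Q))
  repunit-^ Q (suc m) = begin
    Q ℕ.* Q ℕ.^ m ℕ.+ suc (Q ℕ.* repunit Q m)   ≡⟨ ℕ.+-suc _ _ ⟩
    suc (Q ℕ.* Q ℕ.^ m ℕ.+ Q ℕ.* repunit Q m)   ≡⟨ cong suc (ℕ.*-distribˡ-+ Q _ _) ⟨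
    suc (Q ℕ.* (Q ℕ.^ m ℕ.+ repunit Q m))       ≡⟨ cong (λ k → suc (Q ℕ.* k)) (repunit-^ Q m) ⟩
    suc (Q ℕ.* repunit Q (suc m))               ∎
    where open ≡-Reasoning

  -- With N = `repunit Q m` one has 1 + NQ = Q^m + N, and x^(Q^m) = x; hence x (x^N)^Q = x x^N, and
  -- a nonzero x cancels.
  norm-fixed : ∀ Q m → 0 ℕ.< Q → 0 ℕ.< m → order ≡ Q ℕ.^ m → ∀ x →
               (x ^ repunit Q m) ^ Q ≡ x ^ repunit Q m
  norm-fixed Q (suc m) 0<Q _ order≡ x with x ≟ 0#
  ... | yes refl = trans (cong (_^ Q) (0^ {repunit Q (suc m)} (s≤s z≤n)))
                         (trans (0^ 0<Q) (sym (0^ {repunit Q (suc m)} (s≤s z≤n))))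
  ... | no x≢0 = *-cancelˡ x≢0 (begin
    x * (x ^ N) ^ Q             ≡⟨ cong (x *_) (^-^ x N Q) ⟩
    x * x ^ (N ℕ.* Q)           ≡⟨ cong (λ k → x * x ^ k) (ℕ.*-comm N Q) ⟩
    x ^ repunit Q (suc (suc m)) ≡⟨ cong (x ^_) (repunit-^ Q (suc m)) ⟨
    x ^ (Q ℕ.^ suc m ℕ.+ N)     ≡⟨ ^-+ x (Q ℕ.^ suc m) N ⟩
    x ^ (Q ℕ.^ suc m) * x ^ N   ≡⟨ cong (λ k → x ^ k * x ^ N) order≡ ⟨
    x ^ order * x ^ N           ≡⟨ cong (_* x ^ N) (x^order≡x x) ⟩
    x * x ^ N                   ∎)
    where
    open ≡-Reasoning
    N = repunit Q (suc m)

  -- The fibres of the norm have at most N elements, hence Q^m ≤ |fixed Q| N.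
  length-fixed-≥ : ∀ Q m → 0 ℕ.< m → order ≡ Q ℕ.^ m → Q ℕ.≤ length (fixed Q)
  -- With fewer than Q fixed points, adding N to both sides would give Q^m + N ≤ Q N, whereas the
  -- left side equals Q N + 1.
  length-fixed-≥ Q m@(suc _) 0<m order≡ = ℕ.≮⇒≥ λ s<Q → ℕ.<-irrefl refl (begin-strict
    Q ℕ.^ m ℕ.+ N                  ≡⟨ cong (ℕ._+ N) order≡ ⟨
    order ℕ.+ N                    ≤⟨ ℕ.+-monoˡ-≤ N (order≤ (ℕ.≤-trans (s≤s z≤n) s<Q)) ⟩
    length (fixed Q) ℕ.* N ℕ.+ N   ≡⟨ ℕ.+-comm _ N ⟩
    suc (length (fixed Q)) ℕ.* N   ≤⟨ ℕ.*-monoˡ-≤ N s<Q ⟩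
    Q ℕ.* N                        <⟨ ℕ.n<1+n _ ⟩
    repunit Q (suc m)              ≡⟨ repunit-^ Q m ⟨
    Q ℕ.^ m ℕ.+ N                  ∎)
    where
    open ℕ.≤-Reasoning
    N = repunit Q m
    order≤ : 0 ℕ.< Q → order ℕ.≤ length (fixed Q) ℕ.* N
    order≤ 0<Q = length-≤-fibres _≟_ (_^ N) N (length-^-fibre-≤ N (s≤s z≤n)) elems-unique (fixed Q)
      (All.tabulate (λ {x} _ → ∈-fixed⁺ Q (norm-fixed Q m 0<Q 0<m order≡ x)))

  -- The loop in the definition of qPoly is local and has no name: it is recovered here as the
  -- solution of a metavariable, fixed by unification once its arguments are abstracted to variables.
  mutual
    qPoly-loop : (q N : ℕ) → (Fin (suc N) → F) → F → ℕ → (m : ℕ) → (Fin m → F) → F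
    qPoly-loop = _

    qPoly-unfold : ∀ q n (a : Fin (suc (suc n)) → F) x → qPoly q (suc (suc n)) a x ≡
      a zero * (x ^ (q ℕ.^ 0)) + (a (suc zero) * (x ^ (q ℕ.^ 1)) + qPoly-loop q (suc n) a x 2 n (λ i → a (suc (suc i))))
    qPoly-unfold q n a x with suc n | a | 2 | (λ i → a (suc (suc i))) | a (suc zero)
    ... | _ | _ | _ | _ | _ = refl

  -- Additivity and F_q-homogeneity of q-polynomials

  module _ {q} (additive : ∀ s x y → (x + y) ^ (q ℕ.^ s) ≡ x ^ (q ℕ.^ s) + y ^ (q ℕ.^ s)) where

    +-step : ∀ s a x y {u v w} → u ≡ v + w →
             a * (x + y) ^ (q ℕ.^ s) + u ≡ (a * x ^ (q ℕ.^ s) + v) + (a * y ^ (q ℕ.^ s) + w)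
    +-step s a x y {v = v} {w} refl = trans (cong (λ z → a * z + (v + w)) (additive s x y))
      (solve 5 (λ a x y v w → a :* (x :+ y) :+ (v :+ w) := (a :* x :+ v) :+ (a :* y :+ w)) refl a _ _ v w)

    qPoly-loop-+ : ∀ N a j m b x y →
      qPoly-loop q N a (x + y) j m b ≡ qPoly-loop q N a x j m b + qPoly-loop q N a y j m b
    qPoly-loop-+ N a j zero    b x y = sym (+-identityˡ 0#)
    qPoly-loop-+ N a j (suc m) b x y = +-step j (b zero) x y (qPoly-loop-+ N a (suc j) m (b ∘ suc) x y)

    qPoly-+ : ∀ n a x y → qPoly q n a (x + y) ≡ qPoly q n a x + qPoly q n a y
    qPoly-+ zero    a x y = sym (+-identityˡ 0#)
    qPoly-+ (suc n) a x y = +-step 0 (a zero) x y (qPoly-loop-+ n a 1 n (a ∘ suc) x y)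

  -- The monomials involve all the exponents q^s, so `c` has to be fixed by each of these power
  -- maps; elements of F_q are, by `InSub1⇒InSub`.
  module _ {q c} (c∈ : ∀ s → InSub q s c) where

    *-step : ∀ s a x {u v} → u ≡ c * v → a * (c * x) ^ (q ℕ.^ s) + u ≡ c * (a * x ^ (q ℕ.^ s) + v)
    *-step s a x {v = v} refl = trans
      (cong (λ z → a * z + c * v) (trans (*-^ c x (q ℕ.^ s)) (cong (_* x ^ (q ℕ.^ s)) (c∈ s))))
      (solve 4 (λ a c x v → a :* (c :* x) :+ c :* v := c :* (a :* x :+ v)) refl a c _ v)

    qPoly-loop-* : ∀ N a j m b x → qPoly-loop q N a (c * x) j m b ≡ c * qPoly-loop q N a x j m b
    qPoly-loop-* N a j zero    b x = sym (zeroʳ c)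
    qPoly-loop-* N a j (suc m) b x = *-step j (b zero) x (qPoly-loop-* N a (suc j) m (b ∘ suc) x)

    qPoly-* : ∀ n a x → qPoly q n a (c * x) ≡ c * qPoly q n a x
    qPoly-* zero    a x = sym (zeroʳ c)
    qPoly-* (suc n) a x = *-step 0 (a zero) x (qPoly-loop-* n a 1 n (a ∘ suc) x)

-- Growth of powers, and products of lists

n<m^n : ∀ {m} → 2 ℕ.≤ m → ∀ n → n ℕ.< m ℕ.^ n
n<m^n 2≤m zero = s≤s z≤n
n<m^n {m} 2≤m (suc n) = begin-strict
  suc n                      ≤⟨ n<m^n 2≤m n ⟩
  m ℕ.^ n                    <⟨ ℕ.m<m+n _ (ℕ.≤-trans (s≤s z≤n) (n<m^n 2≤m n)) ⟩
  m ℕ.^ n ℕ.+ m ℕ.^ n        ≡⟨ cong (m ℕ.^ n ℕ.+_) (ℕ.+-identityʳ _) ⟨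
  2 ℕ.* m ℕ.^ n              ≤⟨ ℕ.*-monoˡ-≤ (m ℕ.^ n) 2≤m ⟩
  m ℕ.* m ℕ.^ n              ∎
  where open ℕ.≤-Reasoning

^-injectiveʳ : ∀ {q} → 2 ℕ.≤ q → ∀ {m n} → q ℕ.^ m ≡ q ℕ.^ n → m ≡ n
^-injectiveʳ {q} 2≤q {m} {n} eq with ℕ.<-cmp m n
... | tri≈ _ m≡n _ = m≡n
... | tri< m<n _ _ = contradiction eq (ℕ.<⇒≢ (ℕ.^-monoʳ-< q 2≤q m<n))
... | tri> _ _ n<m = contradiction (sym eq) (ℕ.<⇒≢ (ℕ.^-monoʳ-< q 2≤q n<m))

prime-power-≥2 : ∀ {q} → IsPrimePower q → 2 ℕ.≤ q
prime-power-≥2 (p , suc k , p-prime , _ , refl) = begin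
  2             ≤⟨ ℕ.nonTrivial⇒n>1 p {{prime⇒nonTrivial p-prime}} ⟩
  p             ≡⟨ ℕ.*-identityʳ p ⟨
  p ℕ.* 1       ≤⟨ ℕ.*-monoʳ-≤ p (ℕ.m^n>0 p {{prime⇒nonZero p-prime}} k) ⟩
  p ℕ.^ suc k   ∎
  where open ℕ.≤-Reasoning

length-cartesianProductWith : {A B C : Set} (f : A → B → C) (xs : List A) (ys : List B) →
  length (cartesianProductWith f xs ys) ≡ length xs ℕ.* length ys
length-cartesianProductWith f []       ys = refl
length-cartesianProductWith f (x ∷ xs) ys = trans (length-++ (map (f x) ys))
  (cong₂ ℕ._+_ (length-map (f x) ys) (length-cartesianProductWith f xs ys))

AllPairs-zip-All : {A : Set} {R : A → A → Set} {P : A → Set} {xs : List A} →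
  AllPairs R xs → All P xs → AllPairs (λ x y → R x y × P x × P y) xs
AllPairs-zip-All [] [] = []
AllPairs-zip-All (rs ∷ rss) (p ∷ ps) =
  All.zipWith (λ (r , p′) → r , p , p′) (rs , ps) ∷ AllPairs-zip-All rss ps

-- Linear algebra over the subfield of order q

module Subfield (K : FiniteField) {q n : ℕ} (q-pp : IsPrimePower q) (0<n : 0 ℕ.< n)
                (order≡ : FiniteField.order K ≡ q ℕ.^ n) where
  open FiniteField K
  open FieldProperties K
  open ≡-Reasoning

  2≤q : 2 ℕ.≤ q
  2≤q = prime-power-≥2 q-pp

  q-additive : ∀ s x y → (x + y) ^ (q ℕ.^ s) ≡ x ^ (q ℕ.^ s) + y ^ (q ℕ.^ s)
  q-additive = prime-power-frobenius-+ q-pp n order≡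

  InSub-1 : ∀ s → InSub q s 1#
  InSub-1 s = 1^ (q ℕ.^ s)

  InSub-0 : ∀ s → InSub q s 0#
  InSub-0 s = 0^ (ℕ.m^n>0 q {{ℕ.>-nonZero (ℕ.≤-trans (s≤s z≤n) 2≤q)}} s)

  InSub-* : ∀ s {x y} → InSub q s x → InSub q s y → InSub q s (x * y)
  InSub-* s {x} {y} x∈ y∈ = trans (*-^ x y (q ℕ.^ s)) (cong₂ _*_ x∈ y∈)

  InSub-⁻¹ : ∀ s {x} → x ≢ 0# → InSub q s x → InSub q s (x ⁻¹)
  InSub-⁻¹ s {x} x≢0 x∈ = *-cancelˡ x≢0 (begin
    x * (x ⁻¹) ^ Q         ≡⟨ cong (_* (x ⁻¹) ^ Q) x∈ ⟨
    x ^ Q * (x ⁻¹) ^ Q     ≡⟨ *-^ x (x ⁻¹) Q ⟨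
    (x * x ⁻¹) ^ Q         ≡⟨ cong (_^ Q) (inverse x x≢0) ⟩
    1# ^ Q                 ≡⟨ 1^ Q ⟩
    1#                     ≡⟨ inverse x x≢0 ⟨
    x * x ⁻¹               ∎)
    where Q = q ℕ.^ s

  InSub-+ : ∀ s {x y} → InSub q s x → InSub q s y → InSub q s (x + y)
  InSub-+ s {x} {y} x∈ y∈ = trans (q-additive s x y) (cong₂ _+_ x∈ y∈)

  -- Applying the additive map x ↦ x^(q^s) to 1 + (-1) = 0 treats odd and even q alike.
  InSub--1 : ∀ s → InSub q s (- 1#)
  InSub--1 s = +-cancelˡ 1# _ _ (begin
    1# + (- 1#) ^ Q        ≡⟨ cong (_+ (- 1#) ^ Q) (1^ Q) ⟨
    1# ^ Q + (- 1#) ^ Q    ≡⟨ q-additive s 1# (- 1#) ⟨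
    (1# + - 1#) ^ Q        ≡⟨ cong (_^ Q) (-‿inverseʳ 1#) ⟩
    0# ^ Q                 ≡⟨ InSub-0 s ⟩
    0#                     ≡⟨ -‿inverseʳ 1# ⟨
    1# + - 1#              ∎)
    where Q = q ℕ.^ s

  InSub1⇒InSub : ∀ s {x} → InSub q 1 x → InSub q s x
  InSub1⇒InSub zero {x} _ = *-identityʳ x
  InSub1⇒InSub (suc s) {x} x∈ = begin
    x ^ (q ℕ.* q ℕ.^ s)    ≡⟨ ^-^ x q (q ℕ.^ s) ⟨
    (x ^ q) ^ (q ℕ.^ s)    ≡⟨ cong (λ k → (x ^ k) ^ (q ℕ.^ s)) (ℕ.*-identityʳ q) ⟨
    (x ^ (q ℕ.^ 1)) ^ (q ℕ.^ s)  ≡⟨ cong (_^ (q ℕ.^ s)) x∈ ⟩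
    x ^ (q ℕ.^ s)          ≡⟨ InSub1⇒InSub s x∈ ⟩
    x                      ∎

  InSub-n : ∀ x → InSub q n x
  InSub-n x = trans (cong (x ^_) (sym order≡)) (x^order≡x x)

  Scalar : F → Set
  Scalar = InSub q 1

  scalars : List F
  scalars = fixed (q ℕ.^ 1)

  length-scalars : length scalars ≡ q
  length-scalars rewrite ℕ.*-identityʳ q =
    ℕ.≤-antisym (length-fixed-≤ q 2≤q) (length-fixed-≥ q n 0<n order≡)

  ·-zeroˡ : ∀ v → 0# · v ≡ 0V
  ·-zeroˡ (x , y) = cong₂ _,_ (zeroˡ x) (zeroˡ y)

  ·-identityˡ : ∀ v → 1# · v ≡ v
  ·-identityˡ (x , y) = cong₂ _,_ (*-identityˡ x) (*-identityˡ y)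

  ·-assoc : ∀ a b v → (a * b) · v ≡ a · (b · v)
  ·-assoc a b (x , y) = cong₂ _,_ (*-assoc a b x) (*-assoc a b y)

  ⊕-identityʳ : ∀ v → (v ⊕ 0V) ≡ v
  ⊕-identityʳ (x , y) = cong₂ _,_ (+-identityʳ x) (+-identityʳ y)

  ⊕-identityˡ : ∀ v → (0V ⊕ v) ≡ v
  ⊕-identityˡ (x , y) = cong₂ _,_ (+-identityˡ x) (+-identityˡ y)

  ⊕-inverseʳ : ∀ v → (v ⊕ ((- 1#) · v)) ≡ 0V
  ⊕-inverseʳ (x , y) = cong₂ _,_ (x-x x) (x-x y)
    where
    x-x : ∀ x → x + - 1# * x ≡ 0#
    x-x x = trans (cong (x +_) (-1*x≈-x x)) (-‿inverseʳ x)

  lincomb-cong : ∀ k {c d} b → (∀ i → c i ≡ d i) → lincomb k c b ≡ lincomb k d b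
  lincomb-cong zero b c≗d = refl
  lincomb-cong (suc k) b c≗d = cong₂ _⊕_ (cong (_· b zero) (c≗d zero)) (lincomb-cong k (b ∘ suc) (c≗d ∘ suc))

  lincomb-+ : ∀ k c d b → lincomb k (λ i → c i + d i) b ≡ (lincomb k c b ⊕ lincomb k d b)
  lincomb-+ zero c d b = sym (⊕-identityʳ 0V)
  lincomb-+ (suc k) c d b rewrite lincomb-+ k (c ∘ suc) (d ∘ suc) (b ∘ suc) =
    cong₂ _,_ (step (c zero) (d zero) _ _ _) (step (c zero) (d zero) _ _ _)
    where
    step : ∀ c d x y z → (c + d) * x + (y + z) ≡ (c * x + y) + (d * x + z)
    step = solve 5 (λ c d x y z → (c :+ d) :* x :+ (y :+ z) := (c :* x :+ y) :+ (d :* x :+ z)) refl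

  lincomb-· : ∀ k l c b → lincomb k (λ i → l * c i) b ≡ l · lincomb k c b
  lincomb-· zero l c b = cong₂ _,_ (sym (zeroʳ l)) (sym (zeroʳ l))
  lincomb-· (suc k) l c b rewrite lincomb-· k l (c ∘ suc) (b ∘ suc) =
    cong₂ _,_ (step l (c zero) _ _) (step l (c zero) _ _)
    where
    step : ∀ l c x y → l * c * x + l * y ≡ l * (c * x + y)
    step = solve 4 (λ l c x y → l :* c :* x :+ l :* y := l :* (c :* x :+ y)) refl

  -- Independence, spans and bases

  Independent : ∀ {k} → (Fin k → V) → Set
  Independent {k} b = ∀ (c : Fin k → F) → (∀ i → Scalar (c i)) → lincomb k c b ≡ 0V → ∀ i → c i ≡ 0#

  lincomb-injective : ∀ {k} {b : Fin k → V} → Independent b → ∀ {c d} → (∀ i → Scalar (c i)) → (∀ i → Scalar (d i)) →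
                      lincomb k c b ≡ lincomb k d b → ∀ i → c i ≡ d i
  lincomb-injective {k} {b} indep {c} {d} c∈ d∈ eq i = +-cancelʳ (- 1# * d i) _ _ (begin
    c i + - 1# * d i   ≡⟨ indep (λ i → c i + - 1# * d i) (λ i → InSub-+ 1 (c∈ i) (InSub-* 1 (InSub--1 1) (d∈ i))) c-d≡0 i ⟩
    0#                 ≡⟨ cong proj₁ (⊕-inverseʳ (d i , d i)) ⟨
    d i + - 1# * d i   ∎)
    where
    c-d≡0 : lincomb k (λ i → c i + - 1# * d i) b ≡ 0V
    c-d≡0 = begin
      lincomb k (λ i → c i + - 1# * d i) b               ≡⟨ lincomb-+ k c _ b ⟩
      (lincomb k c b ⊕ lincomb k (λ i → - 1# * d i) b)   ≡⟨ cong₂ _⊕_ eq (lincomb-· k (- 1#) d b) ⟩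
      (lincomb k d b ⊕ ((- 1#) · lincomb k d b))         ≡⟨ ⊕-inverseʳ _ ⟩
      0V                                                 ∎

  -- Coefficient families are listed as vectors because equality of vectors is entrywise, which
  -- makes a duplicate-free enumeration possible.
  coefficients : ∀ k → List (Vec F k)
  coefficients zero    = [] ∷ []
  coefficients (suc k) = cartesianProductWith _∷_ scalars (coefficients k)

  length-coefficients : ∀ k → length (coefficients k) ≡ q ℕ.^ k
  length-coefficients zero    = refl
  length-coefficients (suc k) = trans (length-cartesianProductWith _∷_ scalars (coefficients k))
    (cong₂ ℕ._*_ length-scalars (length-coefficients k))

  coefficients-unique : ∀ k → Unique (coefficients k)
  coefficients-unique zero    = [] ∷ []
  coefficients-unique (suc k) = UniqueProperties.cartesianProductWith⁺ _∷_ ∷-injective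
    (fixed-unique (q ℕ.^ 1)) (coefficients-unique k)

  ∈-coefficients⁻ : ∀ k {v} → v ∈ coefficients k → ∀ i → Scalar (lookup v i)
  ∈-coefficients⁻ (suc k) v∈ i
    with ∈-cartesianProductWith⁻ _∷_ scalars (coefficients k) v∈
  ∈-coefficients⁻ (suc k) v∈ zero    | _ , _ , x∈ , _  , refl = ∈-fixed⁻ (q ℕ.^ 1) x∈
  ∈-coefficients⁻ (suc k) v∈ (suc i) | _ , _ , _  , w∈ , refl = ∈-coefficients⁻ k w∈ i

  ∈-coefficients⁺ : ∀ k {c : Fin k → F} → (∀ i → Scalar (c i)) → tabulate c ∈ coefficients k
  ∈-coefficients⁺ zero    c∈ = here refl
  ∈-coefficients⁺ (suc k) c∈ = ∈-cartesianProductWith⁺ _∷_ (∈-fixed⁺ (q ℕ.^ 1) (c∈ zero)) (∈-coefficients⁺ k (c∈ ∘ suc))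

  span : ∀ {k} → (Fin k → V) → List V
  span {k} b = map (λ v → lincomb k (lookup v) b) (coefficients k)

  length-span : ∀ {k} (b : Fin k → V) → length (span b) ≡ q ℕ.^ k
  length-span {k} b = trans (length-map _ (coefficients k)) (length-coefficients k)

  ∈-span⁺ : ∀ {k} {b : Fin k → V} c → (∀ i → Scalar (c i)) → lincomb k c b ∈ span b
  ∈-span⁺ {k} {b} c c∈ = subst (_∈ span b) (lincomb-cong k b (lookup∘tabulate c))
    (∈-map⁺ _ (∈-coefficients⁺ k c∈))

  ∈-span⁻ : ∀ {k} {b : Fin k → V} {w} → w ∈ span b → Σ (Fin k → F) λ c → (∀ i → Scalar (c i)) × w ≡ lincomb k c b
  ∈-span⁻ {k} w∈ = let v , v∈ , w≡ = ∈-map⁻ _ w∈ in lookup v , ∈-coefficients⁻ k v∈ , w≡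

  span-unique : ∀ {k} {b : Fin k → V} → Independent b → Unique (span b)
  span-unique {k} indep = AllPairsProperties.map⁺ (AllPairs.map
    (λ (v≢w , v∈ , w∈) eq → v≢w (lookup-extensional (lincomb-injective indep v∈ w∈ eq)))
    (AllPairs-zip-All (coefficients-unique k) (All.tabulate (∈-coefficients⁻ k))))
    where
    lookup-extensional : ∀ {v w : Vec F k} → (∀ i → lookup v i ≡ lookup w i) → v ≡ w
    lookup-extensional {v} {w} v≗w =
      trans (sym (tabulate∘lookup v)) (trans (tabulate-cong v≗w) (tabulate∘lookup w))

  -- A relation with nonzero coefficient at `w` could be solved for `w`, which would then lie in the
  -- span.
  independent-∷ : ∀ {k} {b : Fin k → V} {w} → Independent b → w ∉ span b → Independent (w Vector.∷ b)
  independent-∷ {k} {b} {w} indep w∉ c c∈ eq with c zero ≟ 0#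
  ... | yes c₀≡0 = λ { zero → c₀≡0 ; (suc i) → indep (c ∘ suc) (c∈ ∘ suc) rest≡0 i }
    where
    rest≡0 : lincomb k (c ∘ suc) b ≡ 0V
    rest≡0 = begin
      lincomb k (c ∘ suc) b                     ≡⟨ ⊕-identityˡ _ ⟨
      (0V ⊕ lincomb k (c ∘ suc) b)              ≡⟨ cong (_⊕ lincomb k (c ∘ suc) b) (trans (cong (_· w) c₀≡0) (·-zeroˡ w)) ⟨
      ((c zero · w) ⊕ lincomb k (c ∘ suc) b)    ≡⟨ eq ⟩
      0V                                        ∎
  ... | no c₀≢0 = contradiction
    (subst (_∈ span b) w≡ (∈-span⁺ (λ i → a * c (suc i)) (λ i → InSub-* 1 a∈ (c∈ (suc i))))) w∉
    where
    -- From c₀ w + Σ = 0 follows w = -c₀⁻¹ Σ.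
    a = - 1# * c zero ⁻¹
    a∈ = InSub-* 1 (InSub--1 1) (InSub-⁻¹ 1 c₀≢0 (c∈ zero))
    solve-for : ∀ {x y} → c zero * x + y ≡ 0# → a * y ≡ x
    solve-for {x} {y} eq = *-cancelˡ c₀≢0 (begin
      c zero * (- 1# * c zero ⁻¹ * y)    ≡⟨ solve 4 (λ c m i y → c :* (m :* i :* y) := c :* i :* (m :* y)) refl (c zero) (- 1#) (c zero ⁻¹) y ⟩
      c zero * c zero ⁻¹ * (- 1# * y)    ≡⟨ cong (_* (- 1# * y)) (inverse (c zero) c₀≢0) ⟩
      1# * (- 1# * y)                    ≡⟨ *-identityˡ _ ⟩
      - 1# * y                           ≡⟨ -1*x≈-x y ⟩
      - y                                ≡⟨ +-inverseˡ-unique _ _ eq ⟨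
      c zero * x                         ∎)
    w≡ : lincomb k (λ i → a * c (suc i)) b ≡ w
    w≡ = trans (lincomb-· k a (c ∘ suc) b)
               (cong₂ _,_ (solve-for (cong proj₁ eq)) (solve-for (cong proj₂ eq)))

  _≟V_ : DecidableEquality V
  _≟V_ = ≡-dec _≟_ _≟_

  module _ {W : V → Set} {Ws : List V} (Ws-unique : Unique Ws)
           (∈-Ws⁺ : ∀ {w} → W w → w ∈ Ws) (∈-Ws⁻ : ∀ {w} → w ∈ Ws → W w)
           (W-lincomb : ∀ {k} c b → (∀ i → Scalar (c i)) → (∀ i → W (b i)) → W (lincomb k c b)) where

    span⊆ : ∀ {k} {b : Fin k → V} → (∀ i → W (b i)) → ∀ {w} → w ∈ span b → w ∈ Ws
    span⊆ {b = b} b∈ w∈ with c , c∈ , refl ← ∈-span⁻ {b = b} w∈ = ∈-Ws⁺ (W-lincomb c b c∈ b∈)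

    q^k≤length : ∀ {k} {b : Fin k → V} → Independent b → (∀ i → W (b i)) → q ℕ.^ k ℕ.≤ length Ws
    q^k≤length {b = b} indep b∈ = subst (ℕ._≤ length Ws) (length-span b)
      (unique-⊆⇒length-≤ (span-unique indep) (span⊆ b∈))

    -- Adjoin vectors of W outside the span until there are none; the span is then all of W, and
    -- counting it gives q^d = |W|. `fuel` bounds the vectors still to be adjoined.
    extend-to-basis : ∀ fuel {k} {b : Fin k → V} → length Ws ℕ.≤ fuel ℕ.+ k → Independent b → (∀ i → W (b i)) →
                      ∃ λ d → HasDimOver q W d × q ℕ.^ d ≡ length Ws
    extend-to-basis fuel {k} {b} ≤fuel indep b∈ with any? (λ w → ¬? (any? (w ≟V_) (span b))) Ws
    extend-to-basis fuel {k} {b} ≤fuel indep b∈ | no none =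
      k , (b , b∈ , indep , (λ w w∈ → ∈-span⁻ (Ws⊆ (∈-Ws⁺ w∈)))) ,
      ℕ.≤-antisym (q^k≤length indep b∈)
        (subst (length Ws ℕ.≤_) (length-span b) (unique-⊆⇒length-≤ Ws-unique Ws⊆))
      where
      Ws⊆ : ∀ {w} → w ∈ Ws → w ∈ span b
      Ws⊆ {w} w∈ = decidable-stable (any? (w ≟V_) (span b)) (λ w∉ → none (lose w∈ w∉))
    -- Without fuel |W| ≤ k, yet k independent vectors have q^k > k distinct combinations in W.
    extend-to-basis zero {k} ≤fuel indep b∈ | yes _ =
      contradiction (ℕ.≤-trans (q^k≤length indep b∈) ≤fuel) (ℕ.<⇒≱ (n<m^n 2≤q k))
    extend-to-basis (suc fuel) {k} {b} ≤fuel indep b∈ | yes some with w , w∈ , w∉ ← find some =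
      extend-to-basis fuel {b = w Vector.∷ b} (subst (length Ws ℕ.≤_) (sym (ℕ.+-suc fuel k)) ≤fuel) (independent-∷ indep w∉)
        (λ { zero → ∈-Ws⁻ w∈ ; (suc i) → b∈ i })

    basis : ∃ λ d → HasDimOver q W d × q ℕ.^ d ≡ length Ws
    basis = extend-to-basis (length Ws) {b = λ ()} (ℕ.m≤m+n _ 0) (λ _ _ _ ()) (λ ())

  -- Equality of points as an equivalence relation

  SamePt-isEquivalence : ∀ s → IsEquivalence (SamePt q s)
  SamePt-isEquivalence s = record
    { refl = λ {v} → 1# , InSub-1 s , 0≢1 ∘ sym , sym (·-identityˡ v)
    ; sym = λ { {v} {w} (l , l∈ , l≢0 , refl) → l ⁻¹ , InSub-⁻¹ s l≢0 l∈ , ⁻¹≢0 l≢0 ,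
        (begin
          w                  ≡⟨ ·-identityˡ w ⟨
          1# · w             ≡⟨ cong (_· w) (trans (*-comm _ _) (inverse l l≢0)) ⟨
          (l ⁻¹ * l) · w     ≡⟨ ·-assoc _ _ w ⟩
          (l ⁻¹) · (l · w)     ∎) }
    ; trans = λ { {k = w} (l , l∈ , l≢0 , refl) (m , m∈ , m≢0 , refl) →
        l * m , InSub-* s l∈ m∈ , *≢0 l≢0 m≢0 , sym (·-assoc l m w) }
    }

  -- Linear sets of q-polynomials

  module LinearSet {f : F → F} (f-+ : ∀ x y → f (x + y) ≡ f x + f y)
                   (f-* : ∀ {c} → Scalar c → ∀ x → f (c * x) ≡ c * f x) where

    f0≡0 : f 0# ≡ 0#
    f0≡0 = trans (cong f (sym (zeroˡ 0#))) (trans (f-* (InSub-0 1) 0#) (zeroˡ _))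

    graph : List V
    graph = map (λ y → y , f y) elems

    ∈-graph⁻ : ∀ {v} → v ∈ graph → InU f v
    ∈-graph⁻ v∈ with _ , _ , refl ← ∈-map⁻ _ v∈ = refl

    ∈-Ustar⁺ : ∀ {v} → InU f v → v ≢ 0V → v ∈ Ustar f
    ∈-Ustar⁺ {y , _} refl v≢0 = ∈-filter⁺ _ (∈-map⁺ _ (elems-complete y)) v≢0

    ∈-Ustar⁻ : ∀ {v} → v ∈ Ustar f → InU f v × v ≢ 0V
    ∈-Ustar⁻ v∈ with v∈U , v≢0 ← ∈-filter⁻ (λ v → ¬? (v ≟V 0V)) {xs = graph} v∈ = ∈-graph⁻ v∈U , v≢0

    proj₁≢0 : ∀ {v} → InU f v → v ≢ 0V → proj₁ v ≢ 0#
    proj₁≢0 {_ , _} refl v≢0 refl = v≢0 (cong (0# ,_) f0≡0)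

    ≢0V : ∀ {y} → y ≢ 0# → (y , f y) ≢ 0V
    ≢0V y≢0 = y≢0 ∘ cong proj₁

    collinear⇒same-slope : ∀ {y z l} → y ≢ 0# → z ≢ 0# → y ≡ l * z → f y ≡ l * f z → f y * y ⁻¹ ≡ f z * z ⁻¹
    collinear⇒same-slope {y} {z} {l} y≢0 z≢0 y≡ fy≡ = *-cancelʳ y≢0 (begin
      f y * y ⁻¹ * y          ≡⟨ *x⁻¹*x (f y) y≢0 ⟩
      f y                     ≡⟨ fy≡ ⟩
      l * f z                 ≡⟨ cong (l *_) (*x⁻¹*x (f z) z≢0) ⟨
      l * (f z * z ⁻¹ * z)    ≡⟨ solve 3 (λ l a z → l :* (a :* z) := a :* (l :* z)) refl l (f z * z ⁻¹) z ⟩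
      f z * z ⁻¹ * (l * z)    ≡⟨ cong (f z * z ⁻¹ *_) y≡ ⟨
      f z * z ⁻¹ * y          ∎)

    same-slope⇒collinear : ∀ {y z} → y ≢ 0# → z ≢ 0# → f y * y ⁻¹ ≡ f z * z ⁻¹ → (y , f y) ≡ ((y * z ⁻¹) · (z , f z))
    same-slope⇒collinear {y} {z} y≢0 z≢0 eq = cong₂ _,_ (sym (*x⁻¹*x y z≢0)) (begin
      f y                     ≡⟨ *x⁻¹*x (f y) y≢0 ⟨
      f y * y ⁻¹ * y          ≡⟨ cong (_* y) eq ⟩
      f z * z ⁻¹ * y          ≡⟨ solve 3 (λ a i y → a :* i :* y := y :* i :* a) refl (f z) (z ⁻¹) y ⟩
      y * z ⁻¹ * f z          ∎)

    -- The common form of both notions: L-q^t-partial scatteredness is SlopesRefine n t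
    -- and R-q^t-partial scatteredness is SlopesRefine t 1.
    SlopesRefine : ℕ → ℕ → Set
    SlopesRefine s r = ∀ y z → y ≢ 0# → z ≢ 0# → f y * y ⁻¹ ≡ f z * z ⁻¹ →
                       InSub q s (y * z ⁻¹) → InSub q r (y * z ⁻¹)

    -- For s = n and r = t this is injectivity of the natural map from R_f to L_f; for s = t and r =
    -- 1 it is injectivity of μ.
    PointsRefine : ℕ → ℕ → Set
    PointsRefine s r = ∀ {v w} → v ∈ Ustar f → w ∈ Ustar f → SamePt q s v w → SamePt q r v w

    -- First coordinates force a scalar taking (z, f(z)) to (y, f(y)) to be y/z, so the scalar that
    -- comes with the finer point is y/z itself.
    points⇒slopes : ∀ {s r} → PointsRefine s r → SlopesRefine s r
    points⇒slopes {r = r} refine y z y≢0 z≢0 eq l∈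
      with m , m∈ , _ , v≡ ← refine (∈-Ustar⁺ refl (≢0V y≢0)) (∈-Ustar⁺ refl (≢0V z≢0))
             (y * z ⁻¹ , l∈ , *≢0 y≢0 (⁻¹≢0 z≢0) , same-slope⇒collinear y≢0 z≢0 eq) =
      subst (InSub q r) (sym (trans (cong (_* z ⁻¹) (cong proj₁ v≡)) (*x*x⁻¹ m z≢0))) m∈

    -- The given scalar `l` equals y/z, so it serves again once the hypothesis has placed it in
    -- F_{q^r}.
    slopes⇒points : ∀ {s r} → SlopesRefine s r → PointsRefine s r
    slopes⇒points {s} {r} refine {y , _} {z , _} v∈ w∈ (l , l∈ , l≢0 , v≡)
      with refl , v≢0 ← ∈-Ustar⁻ v∈ | refl , w≢0 ← ∈-Ustar⁻ w∈ =
      l , subst (InSub q r) ratio (refine y z y≢0 z≢0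
            (collinear⇒same-slope y≢0 z≢0 (cong proj₁ v≡) (cong proj₂ v≡))
            (subst (InSub q s) (sym ratio) l∈)) ,
      l≢0 , v≡
      where
      y≢0 = proj₁≢0 refl v≢0
      z≢0 = proj₁≢0 refl w≢0
      ratio : y * z ⁻¹ ≡ l
      ratio = trans (cong (_* z ⁻¹) (cong proj₁ v≡)) (*x*x⁻¹ l z≢0)

    -- The F_{q^t}-relation is contained in the F_{q^n}-relation, so equally many classes force the
    -- two to agree on U_f^*. Conversely, agreement makes the two lists of representatives
    -- identical.
    equinumerous⇔L : ∀ t → (numPoints q t f ≡ numPoints q n f) ⇔ L-PartiallyScattered q t f
    equinumerous⇔L t = mk⇔
      (λ eq y z y≢0 z≢0 slopes≡ → points⇒slopes {n} {t}
        (deduplicate-length⁻ (SamePt? q t) (SamePt? q n) (SamePt-isEquivalence t) (SamePt-isEquivalence n)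
          t⇒n (Ustar f) eq) y z y≢0 z≢0 slopes≡ (InSub-n _))
      (λ L → cong length (deduplicate-cong (SamePt? q t) (SamePt? q n) (λ v∈ w∈ → mk⇔ t⇒n
        (slopes⇒points {n} {t} (λ y z y≢0 z≢0 slopes≡ _ → L y z y≢0 z≢0 slopes≡) v∈ w∈))))
      where
      t⇒n : ∀ {v w} → SamePt q t v w → SamePt q n v w
      t⇒n (l , _ , rest) = l , InSub-n l , rest

    -- The vector v is itself a basis of its point's intersection with U_f: a nonzero multiple l v
    -- in U_f is also an F_q-multiple of v.
    R⇒scattered : ∀ t → R-PartiallyScattered q t f → ScatteredLS q t f
    R⇒scattered t R (v , v∈ , v≢0) =
      (λ _ → v) ,
      (λ _ → (1# , InSub-1 t , sym (·-identityˡ v)) , v∈) ,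
      (λ { c _ eq zero → coefficient≡0 (cong proj₁ eq) }) ,
      multiple
      where
      coefficient≡0 : ∀ {c} → c * proj₁ v + 0# ≡ 0# → c ≡ 0#
      coefficient≡0 eq = *-cancelʳ (proj₁≢0 v∈ v≢0) (trans (sym (+-identityʳ _)) (trans eq (sym (zeroˡ _))))
      multiple : ∀ w → (∃[ l ] (InSub q t l × w ≡ (l · v))) × InU f w →
                 Σ (Fin 1 → F) λ c → (∀ i → Scalar (c i)) × w ≡ lincomb 1 c (λ _ → v)
      multiple w ((l , l∈ , w≡) , w∈) with w ≟V 0V
      -- The zero vector represents no point and is treated apart.
      ... | yes refl = (λ _ → 0#) , (λ _ → InSub-0 1) , sym (trans (⊕-identityʳ _) (·-zeroˡ v))
      ... | no w≢0 with slopes⇒points {t} {1} R (∈-Ustar⁺ w∈ w≢0) (∈-Ustar⁺ v∈ v≢0)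
                         (l , l∈ , (λ l≡0 → w≢0 (trans w≡ (trans (cong (_· v) l≡0) (·-zeroˡ v)))) , w≡)
      ...   | m , m∈ , _ , w≡mv = (λ _ → m) , (λ _ → m∈) , trans w≡mv (sym (⊕-identityʳ _))

    -- Both v and w lie in the intersection of U_f with the point of w. That space has dimension one
    -- over F_q, so both are F_q-multiples of its basis vector.
    scattered⇒points : ∀ t → ScatteredLS q t f → PointsRefine t 1
    scattered⇒points t scattered {v} {w} v∈ w∈ (l , l∈ , _ , v≡)
      with v∈U , v≢0 ← ∈-Ustar⁻ v∈ | w∈U , w≢0 ← ∈-Ustar⁻ w∈
      with b , _ , _ , spanning ← scattered (w , w∈U , w≢0)
      with c , c∈ , v≡cb ← spanning v ((l , l∈ , v≡) , v∈U)
         | d , d∈ , w≡db ← spanning w ((1# , InSub-1 t , sym (·-identityˡ w)) , w∈U) =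
      SamePt.trans (same (c∈ zero) v≢0 v≡cb) (SamePt.sym (same (d∈ zero) w≢0 w≡db))
      where
      module SamePt = IsEquivalence (SamePt-isEquivalence 1)
      same : ∀ {u c} → Scalar c → u ≢ 0V → u ≡ ((c · b zero) ⊕ 0V) → SamePt q 1 u (b zero)
      same {u} {c} c∈ u≢0 u≡ = c , c∈ , (λ { refl → u≢0 (trans u≡cb (·-zeroˡ (b zero))) }) , u≡cb
        where
        u≡cb : u ≡ (c · b zero)
        u≡cb = trans u≡ (⊕-identityʳ _)

    scattered⇔R : ∀ t → ScatteredLS q t f ⇔ R-PartiallyScattered q t f
    scattered⇔R t = mk⇔ (λ scattered → points⇒slopes {t} {1} (scattered⇒points t scattered)) (R⇒scattered t)

    scattered⇒μ-bijective : ∀ t → ScatteredLS q t f → MuBijective q t f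
    scattered⇒μ-bijective t scattered =
      (λ {x} {y} → scattered⇒points t scattered (∈U x) (∈U y)) ,
      -- Surjectivity is asked for all representatives of the preimage, so F_q ⊆ F_{q^t} enters
      -- here.
      (λ y → y , λ { (l , l∈ , rest) → l , InSub1⇒InSub t l∈ , rest })
      where
      ∈U : (v : UstarT f) → proj₁ v ∈ Ustar f
      ∈U (_ , v∈ , v≢0) = ∈-Ustar⁺ v∈ v≢0

    InU-lincomb : ∀ {k} c u → (∀ i → Scalar (c i)) → (∀ i → InU f (u i)) → InU f (lincomb k c u)
    InU-lincomb {zero} c u _ _ = f0≡0
    InU-lincomb {suc k} c u c∈ u∈ = trans (f-+ _ _) (cong₂ _+_
      (trans (f-* (c∈ zero) _) (cong (c zero *_) (u∈ zero)))
      (InU-lincomb {k} (c ∘ suc) (u ∘ suc) (c∈ ∘ suc) (u∈ ∘ suc)))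

    -- U_f has one vector for each of the q^n field elements, so q^d = q^n for its dimension d.
    dim-U : HasDimOver q (InU f) n
    dim-U with d , dim , q^d≡ ← basis {InU f} {graph}
                 (UniqueProperties.map⁺ (cong proj₁) elems-unique)
                 (λ { {y , _} refl → ∈-map⁺ _ (elems-complete y) })
                 ∈-graph⁻
                 (λ {k} → InU-lincomb {k}) =
      subst (HasDimOver q (InU f)) (^-injectiveʳ 2≤q (trans q^d≡ (trans (length-map _ elems) order≡))) dim

    -- The decomposition of F² as U_f ⊕ ωU_f

    module _ {s ω} (R : R-PartiallyScattered q s f) (ω∈ : InSub q s ω) (ω∉ : ¬ Scalar ω) where

      _+ω_ : F → F → V
      y +ω z = (y , f y) ⊕ (ω · (z , f z))

      f-‿ : ∀ x y → f (x + - 1# * y) ≡ f x + - 1# * f y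
      f-‿ x y = trans (f-+ _ _) (cong (f x +_) (f-* (InSub--1 1) y))

      -- A nonzero common vector of U_f and ωU_f would give equal slopes at y and z with y/z = ω in
      -- F_{q^s}, and R-partial scatteredness would put ω into F_q.
      trivial-intersection : ∀ {y z} → y ≡ ω * z → f y ≡ ω * f z → z ≡ 0#
      trivial-intersection {y} {z} y≡ fy≡ with z ≟ 0#
      ... | yes z≡0 = z≡0
      ... | no z≢0 = contradiction
        (subst Scalar ratio (R y z y≢0 z≢0 (collinear⇒same-slope y≢0 z≢0 y≡ fy≡) (subst (InSub q s) (sym ratio) ω∈))) ω∉
        where
        y≢0 : y ≢ 0#
        -- ω is nonzero because 0 lies in F_q.
        y≢0 y≡0 = *≢0 (λ { refl → ω∉ (InSub-0 1) }) z≢0 (trans (sym y≡) y≡0)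
        ratio : y * z ⁻¹ ≡ ω
        ratio = trans (cong (_* z ⁻¹) y≡) (*x*x⁻¹ ω z≢0)

      difference : ∀ {a b c d} → a + ω * b ≡ c + ω * d → a + - 1# * c ≡ ω * (d + - 1# * b)
      difference {a} {b} {c} {d} eq = +-cancelʳ (c + ω * b) _ _ (begin
        -- The solver works over semirings: -1 is an opaque variable n, and 1 + n = 0 is applied by
        -- hand to the multiples of c and of ωb.
        (a + - 1# * c) + (c + ω * b)            ≡⟨ solve 4 (λ a n c e → (a :+ n :* c) :+ (c :+ e) := (a :+ e) :+ (con 1 :+ n) :* c) refl a (- 1#) c (ω * b) ⟩
        (a + ω * b) + (1# + - 1#) * c      ≡⟨ cong₂ _+_ eq (cong (_* c) (-‿inverseʳ 1#)) ⟩
        (c + ω * d) + 0# * c                    ≡⟨ cong ((c + ω * d) +_) (trans (zeroˡ c) (sym (trans (cong (_* (ω * b)) (-‿inverseʳ 1#)) (zeroˡ (ω * b))))) ⟩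
        (c + ω * d) + (1# + - 1#) * (ω * b) ≡⟨ solve 5 (λ c w d n b → (c :+ w :* d) :+ (con 1 :+ n) :* (w :* b) := w :* (d :+ n :* b) :+ (c :+ w :* b)) refl c ω d (- 1#) b ⟩
        ω * (d + - 1# * b) + (c + ω * b)        ∎)

      x-y≡0⇒x≡y : ∀ {x y} → x + - 1# * y ≡ 0# → x ≡ y
      x-y≡0⇒x≡y {x} {y} eq = +-cancelʳ (- 1# * y) _ _ (trans eq (sym (cong proj₁ (⊕-inverseʳ (y , y)))))

      -- The difference of two representations of one vector gives an element of U_f ∩ ωU_f.
      +ω-injective : ∀ {y z y′ z′} → (y +ω z) ≡ (y′ +ω z′) → (y , z) ≡ (y′ , z′)
      +ω-injective {y} {z} {y′} {z′} eq = cong₂ _,_ (x-y≡0⇒x≡y Δy≡0) (sym (x-y≡0⇒x≡y Δz≡0))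
        where
        Δy≡ : y + - 1# * y′ ≡ ω * (z′ + - 1# * z)
        Δy≡ = difference (cong proj₁ eq)
        Δz≡0 : z′ + - 1# * z ≡ 0#
        Δz≡0 = trivial-intersection Δy≡
          (trans (f-‿ y y′) (trans (difference (cong proj₂ eq)) (cong (ω *_) (sym (f-‿ z′ z)))))
        Δy≡0 : y + - 1# * y′ ≡ 0#
        Δy≡0 = trans Δy≡ (trans (cong (ω *_) Δz≡0) (zeroʳ ω))

      pairs : List (F × F)
      pairs = cartesianProduct elems elems

      ∈-pairs : ∀ v → v ∈ pairs
      ∈-pairs (x , y) = ∈-cartesianProduct⁺ (elems-complete x) (elems-complete y)

      -- Counting replaces a dimension argument: an injective map of the finite set F × F into
      -- itself is onto.
      +ω-surjective : ∀ v → ∃ λ y → ∃ λ z → v ≡ (y +ω z)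
      +ω-surjective v =
        let (y , z) , _ , +ω≡v = find (All.lookup (onto separated covered ℕ.≤-refl) (∈-pairs v))
        in y , z , sym +ω≡v
        where
        open Pigeonhole (λ (yz : F × F) v → (proj₁ yz +ω proj₂ yz) ≡ v)
        separated : Separated pairs
        separated = AllPairs.map (λ ≢ _ eq eq′ → ≢ (+ω-injective (trans eq (sym eq′))))
          (UniqueProperties.cartesianProduct⁺ elems-unique elems-unique)
        covered : All (λ yz → Any (λ v → (proj₁ yz +ω proj₂ yz) ≡ v) pairs) pairs
        covered = All.tabulate (λ {yz} _ → ∈-pairs (proj₁ yz +ω proj₂ yz))

      U-spans : ∀ v → ∃[ k ] Σ (Fin k → F) λ c → Σ (Fin k → V) λ u →
                (∀ i → InSub q s (c i)) × (∀ i → InU f (u i)) × v ≡ lincomb k c u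
      U-spans v =
        let y , z , v≡ = +ω-surjective v
            u = λ { zero → y , f y ; (suc zero) → z , f z }
        in 2 , c , u , c∈ , (λ { zero → refl ; (suc zero) → refl }) ,
           trans v≡ (cong₂ _⊕_ (sym (·-identityˡ (y , f y))) (sym (⊕-identityʳ (ω · (z , f z)))))
        where
        c : Fin 2 → F
        c zero       = 1#
        c (suc zero) = ω
        c∈ : ∀ i → InSub q s (c i)
        c∈ zero       = InSub-1 s
        c∈ (suc zero) = ω∈

  -- Since |F| = (q²)^m, the map x ↦ x^(q²) has at least q² fixed points, more than the q elements
  -- of F_q.
  outside-subfield : ∀ m → n ≡ 2 ℕ.* m → ∃ λ ω → InSub q 2 ω × ¬ Scalar ω
  outside-subfield zero n≡0 = contradiction (ℕ.<-≤-trans 0<n (ℕ.≤-reflexive n≡0)) λ ()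
  outside-subfield m@(suc _) n≡2m with any? (λ x → ¬? (InSub? q 1 x)) (fixed (q ℕ.^ 2))
  ... | yes some = let ω , ω∈ , ω∉ = find some in ω , ∈-fixed⁻ (q ℕ.^ 2) ω∈ , ω∉
  ... | no none = contradiction q²≤q (ℕ.<⇒≱ q<q²)
    where
    q<q² : q ℕ.< q ℕ.^ 2
    q<q² = subst (ℕ._< q ℕ.^ 2) (ℕ.*-identityʳ q) (ℕ.^-monoʳ-< q 2≤q {1} {2} (s≤s (s≤s z≤n)))
    q²≤q : q ℕ.^ 2 ℕ.≤ q
    q²≤q = ℕ.≤-trans
      (length-fixed-≥ (q ℕ.^ 2) m (s≤s z≤n) (trans order≡ (trans (cong (q ℕ.^_) n≡2m) (sym (ℕ.^-*-assoc q 2 m)))))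
      (subst (length (fixed (q ℕ.^ 2)) ℕ.≤_) length-scalars
        (unique-⊆⇒length-≤ (fixed-unique (q ℕ.^ 2)) (λ {x} x∈ → ∈-fixed⁺ (q ℕ.^ 1)
          (decidable-stable (InSub? q 1 x) (λ x∉ → none (lose x∈ x∉))))))

open import Data.Nat using (_*_; _≤_; _^_)

theorem2p3 : (q t t′ n : ℕ) → IsPrimePower q → 2 ≤ t → 2 ≤ t′ → n ≡ t * t′ →
    (K : FiniteField) → FiniteField.order K ≡ q ^ n →
    (a : Fin n → FiniteField.F K) →
    let open FiniteField K
        f = qPoly q n a
    in ((numPoints q t f ≡ numPoints q n f) ⇔ L-PartiallyScattered q t f)
       × (ScatteredLS q t f ⇔ R-PartiallyScattered q t f)
       × (ScatteredLS q t f → MuBijective q t f)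
       × (t ≡ 2 → R-PartiallyScattered q 2 f → CanonicalSubgeometry q 2 n f)
theorem2p3 q t t′ n q-pp 2≤t 2≤t′ n≡tt′ K order≡ a =
  equinumerous⇔L t , scattered⇔R t , scattered⇒μ-bijective t ,
  -- For t = 2 the hypothesis on n reads n = 2t′, so F has (q²)^t′ elements and ω exists.
  λ { refl R → let ω , ω∈ , ω∉ = outside-subfield t′ n≡tt′ in dim-U , U-spans {2} R ω∈ ω∉ }
  where
  0<n : 0 ℕ.< n
  0<n = subst (0 ℕ.<_) (sym n≡tt′) (ℕ.*-mono-≤ (ℕ.≤-trans (s≤s z≤n) 2≤t) (ℕ.≤-trans (s≤s z≤n) 2≤t′))
  open FieldProperties K using (qPoly-+; qPoly-*)
  open Subfield K q-pp 0<n order≡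
  open LinearSet (qPoly-+ q-additive n a) (λ c∈ → qPoly-* (λ s → InSub1⇒InSub s c∈) n a)
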